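{- Let $n,m\ge1$, $X=(x_1,\dots,x_n)$, $Y=(y_1,\dots,y_m)$, and let $\lambda$ be a partition with $\ell(\lambda)\le n+m-2$. Then $\mathrm{hs}_\lambda(X/Y)=s_\lambda(X,Y)$ if and only if $\lambda$ is a staircase partition.
   Context: Partitions $\lambda=(\lambda_1\ge\dots\ge0)$, $\ell(\lambda)$ the number of nonzero parts, $\lambda'$ the conjugate partition. A staircase partition is $(k,k-1,\dots,1)$ for some $k\ge0$ ($k=0$ giving the empty partition). $h_k$ is the complete homogeneous symmetric polynomial ($h_0=1$, $h_k=0$ for $k<0$); Schur polynomial $s_\lambda(Z)=\det(h_{\lambda_i-i+j}(Z))_{1\le i,j\le N}$ and skew Schur polynomial $s_{\lambda/\mu}(Z)=\det(h_{\lambda_i-\mu_j-i+j}(Z))_{1\le i,j\le N}$ for $N\ge\ell(\lambda)$ (zero if $\mu\not\subseteq\lambda$). The hook Schur polynomial is $\mathrm{hs}_\lambda(X/Y)=\sum_{\mu\subseteq\lambda}s_\mu(X)\,s_{\lambda'/\mu'}(Y)$. -}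

module Defs where

open import Data.Nat as ℕ using (ℕ; zero; suc; _≤_; _≥_; _⊓_)
open import Data.Integer as ℤ using (ℤ; +_)
open import Data.List using (List; []; _∷_; [_]; map; foldr; length; filter; upTo; concatMap; allFin)
open import Data.List.Relation.Unary.All using (All)
open import Data.List.Relation.Unary.Linked using (Linked)
open import Data.Fin using (Fin; zero; suc; toℕ; punchIn; _↑ˡ_; _↑ʳ_)
open import Data.Product using (_×_; ∃-syntax)
open import Data.Unit using (⊤)
open import Relation.Binary.PropositionalEquality using (_≡_)

-- Polynomials with integer coefficients in k variables, as iterated
-- coefficient lists:  Poly (suc k) = (Poly k)[z₀], lowest degree first.

Poly : ℕ → Set
Poly zero    = ℤ
Poly (suc k) = List (Poly k)

0P : ∀ {k} → Poly k
0P {zero}  = + 0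
0P {suc k} = []

constP : ∀ {k} → ℤ → Poly k
constP {zero}  c = c
constP {suc k} c = constP c ∷ []

1P : ∀ {k} → Poly k
1P = constP (+ 1)

infixl 6 _+P_
infixl 7 _*P_

_+P_ : ∀ {k} → Poly k → Poly k → Poly k
_+P_ {zero}  a b = a ℤ.+ b
_+P_ {suc k} []      q       = q
_+P_ {suc k} (a ∷ p) []      = a ∷ p
_+P_ {suc k} (a ∷ p) (b ∷ q) = (a +P b) ∷ (p +P q)

-P_ : ∀ {k} → Poly k → Poly k
-P_ {zero}  a = ℤ.- a
-P_ {suc k} p = map -P_ p

_*P_ : ∀ {k} → Poly k → Poly k → Poly k
_*P_ {zero}  a b = a ℤ.* b
_*P_ {suc k} []      q = []
_*P_ {suc k} (a ∷ p) q = map (a *P_) q +P (0P ∷ (p *P q))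

-- the zero polynomial (trailing zero coefficients allowed)
IsZeroP : ∀ {k} → Poly k → Set
IsZeroP {zero}  a       = a ≡ + 0
IsZeroP {suc k} []      = ⊤
IsZeroP {suc k} (a ∷ p) = IsZeroP a × IsZeroP p

infix 4 _≈P_
_≈P_ : ∀ {k} → Poly k → Poly k → Set
p ≈P q = IsZeroP (p +P (-P q))

var : ∀ {k} → Fin k → Poly k
var {suc k} zero    = 0P ∷ 1P ∷ []
var {suc k} (suc i) = var i ∷ []

powP : ∀ {k} → Poly k → ℕ → Poly k
powP p zero    = 1P
powP p (suc e) = p *P powP p e

sumP : ∀ {k} → List (Poly k) → Poly k
sumP = foldr _+P_ 0P

det : ∀ {k} (N : ℕ) → (Fin N → Fin N → Poly k) → Poly k
det zero    M = 1P
det (suc N) M =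
  sumP (map (λ j → powP (-P 1P) (toℕ j) *P M zero j
                    *P det N (λ a b → M (suc a) (punchIn j b)))
            (allFin (suc N)))

hN : ∀ {k} → List (Poly k) → ℕ → Poly k
hN []       zero    = 1P
hN []       (suc d) = 0P
hN (z ∷ zs) d = sumP (map (λ j → powP z j *P hN zs (d ℕ.∸ j)) (upTo (suc d)))

h : ∀ {k} → List (Poly k) → ℤ → Poly k
h zs (+ d)      = hN zs d
h zs ℤ.-[1+ d ] = 0P

IsPartition : List ℕ → Set
IsPartition L = Linked _≥_ L × All (λ x → 1 ≤ x) L

-- λ_{i+1} (0-based index i), 0 beyond the length
part : List ℕ → ℕ → ℕ
part []       _       = 0
part (x ∷ xs) zero    = x
part (x ∷ xs) (suc i) = part xs i

conj : List ℕ → List ℕ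
conj L = map (λ j → length (filter (λ x → suc j ℕ.≤? x) L)) (upTo (part L 0))

stair : ℕ → List ℕ
stair zero    = []
stair (suc k) = suc k ∷ stair k

IsStaircase : List ℕ → Set
IsStaircase L = ∃[ k ] L ≡ stair k

-- all partitions μ ⊆ λ whose first part is ≤ b (as lists of nonzero parts)
subsBounded : List ℕ → ℕ → List (List ℕ)
subsBounded []       b = [ [] ]
subsBounded (l ∷ ls) b =
  [] ∷ concatMap (λ k → map (suc k ∷_) (subsBounded ls (suc k))) (upTo (l ⊓ b))

subPartitions : List ℕ → List (List ℕ)
subPartitions L = subsBounded L (part L 0)

-- Skew Schur and Schur polynomials (Jacobi–Trudi), with N = ℓ(λ)

skewSchur : ∀ {k} → List (Poly k) → List ℕ → List ℕ → Poly k
skewSchur zs L M =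
  det (length L) (λ i j → h zs ((+ part L (toℕ i) ℤ.- + part M (toℕ j)) ℤ.- + toℕ i ℤ.+ + toℕ j))

schur : ∀ {k} → List (Poly k) → List ℕ → Poly k
schur zs L = skewSchur zs L []

hookSchur : ∀ {k} → List (Poly k) → List (Poly k) → List ℕ → Poly k
hookSchur X Y L = sumP (map (λ μ → schur X μ *P skewSchur Y (conj L) (conj μ)) (subPartitions L))

Xvars : (n m : ℕ) → List (Poly (n ℕ.+ m))
Xvars n m = map (λ i → var (i ↑ˡ m)) (allFin n)

Yvars : (n m : ℕ) → List (Poly (n ℕ.+ m))
Yvars n m = map (λ j → var (n ↑ʳ j)) (allFin m)

XYvars : (n m : ℕ) → List (Poly (n ℕ.+ m))
XYvars n m = map var (allFin (n ℕ.+ m))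

{-# OPTIONS --safe #-}
-- All polynomials are minors det(a_{λ_i−μ_j−i+j}) of Toeplitz matrices of power
-- series a(z).  Let H(z) = ∏ 1/(1−x_i z) · ∏ 1/(1−y_j z) be the series of s_λ(X,Y).
-- Expanding the rows for one factor 1+yz gives vertical strips, for one factor
-- 1/(1−yz) horizontal strips, and conjugation exchanges the two; by induction on
-- the number of y's, hs_λ(X/Y) is the minor of K(z) = ∏ (1+y_j z)/∏ (1−x_i z), and
-- K(z) = H(z) ∏ (1−y_j² z²).
--
-- The rows of a staircase minor lie two steps apart, so that multiplication by
-- 1−y²z² is a unitriangular row operation and both minors agree.
--
-- Conversely, put x₁ = t and y₁ = −t.  Then K, hence s_λ(Z,t,−t), does not depend
-- on t, where Z consists of the other n+m−2 variables.  The top coefficient in z₁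
-- of s_λ is s_{(λ₂,λ₃,…)}; by induction (λ₂,λ₃,…) is a staircase δ, and the
-- coefficient of t² reduces to ± a single minor with rows λ₁−2, δ.  It is zero,
-- which by the same top coefficient argument forces two of its rows to be equal.
module Submission where

open import Defs
open import Level using (0ℓ)
open import Algebra.Bundles using (CommutativeRing)
open import Algebra.Properties.CommutativeSemigroup using (interchange; x∙yz≈y∙xz; xy∙z≈y∙xz)
import Algebra.Properties.Ring as RingProperties
import Algebra.Construct.Pointwise as Pointwise
open import Data.Empty using (⊥-elim)
open import Data.Fin using (Fin; zero; suc; toℕ; punchIn; _↑ˡ_; _↑ʳ_; splitAt)
open import Data.Fin.Properties using (toℕ<n; splitAt-↑ˡ; splitAt-↑ʳ)
open import Data.Integer as ℤ using (ℤ; +_)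
import Data.Integer.Properties as ℤ
open import Data.Integer.Tactic.RingSolver using (solve-∀)
open import Data.List using (List; []; _∷_; _++_; map; concatMap; length; filter; upTo; applyUpTo; allFin; tabulate; replicate; cartesianProductWith)
open import Data.List.Membership.Propositional using (_∈_; find; lose)
open import Data.List.Membership.Propositional.Properties using (∈-map⁺; ∈-map⁻; ∈-++⁺ˡ; ∈-++⁺ʳ; ∈-++⁻; ∈-filter⁺; ∈-filter⁻; ∈-cartesianProductWith⁺; ∈-cartesianProductWith⁻; ∈-concatMap⁺; ∈-concatMap⁻; ∈-upTo⁺; ∈-upTo⁻)
open import Data.List.Membership.Propositional.Properties.WithK using (unique∧set⇒bag)
open import Data.List.Properties using (map-upTo; length-applyUpTo; filter-accept; filter-reject; ∷-injectiveˡ; ∷-injectiveʳ; map-∘; map-id-local; ++-assoc; ++-identityʳ; length-replicate; length-++; map-tabulate; map-++)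
open import Data.List.Relation.Binary.BagAndSetEquality using (∼bag⇒↭)
open import Data.List.Relation.Binary.Permutation.Propositional as Perm using (_↭_)
open import Data.List.Relation.Unary.All as All using (All; []; _∷_)
import Data.List.Relation.Unary.All.Properties as AllP
open import Data.List.Relation.Unary.AllPairs as AllPairs using ([]; _∷_)
import Data.List.Relation.Unary.AllPairs.Properties as AllPairsP
open import Data.List.Relation.Unary.Any using (here; there)
open import Data.List.Relation.Unary.Linked using (Linked; []; [-]; _∷_)
open import Data.List.Relation.Unary.Unique.Propositional using (Unique)
import Data.List.Relation.Unary.Unique.Propositional.Properties as Unique
open import Data.Nat as ℕ using (ℕ; zero; suc; _≤_; _<_; z≤n; s≤s; s≤s⁻¹; _∸_; _⊓_)
open import Data.Nat.ListAction using (sum)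
import Data.Nat.Properties as ℕ
open import Data.Product using (_×_; _,_; proj₁; proj₂; ∃-syntax)
open import Data.Sum using (inj₁; inj₂; [_,_]′)
open import Data.Unit using (⊤; tt)
open import Function using (_∘_; id)
open import Function.Bundles using (_⇔_; mk⇔)
open import Relation.Binary.Definitions using (tri<; tri≈; tri>)
open import Relation.Binary.PropositionalEquality as ≡ using (_≡_; _≢_)
import Relation.Binary.Reasoning.Setoid as SetoidReasoning
open import Relation.Nullary using (¬_; yes; no; contradiction)
open import Relation.Unary using (Decidable)

-- `Poly k` is a raw coefficient list, so no identity is manipulated there. The staircase direction
-- is checked in iterated power series rings, where equality implies `≈P`; the converse evaluates
-- the given equality in arbitrary ℤ-algebras. Quantifying over all of these is what makes the
-- converse inductive: to treat t or z₁ as an indeterminate one passes from A to A[[X]] and reads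
-- off a coefficient in X, which is again a statement over A.
--
-- The bound on ℓ(λ) is a budget of variables. Setting x₁ = t and y₁ = -t leaves n+m-2 of them. Each
-- passage to (λ₂, λ₃, ...) removes one row and one variable, and each contradiction comes from a
-- Schur polynomial with at most as many rows as variables, which cannot vanish.
--
-- Strips and conjugates must not change the size of a minor. This is why partitions may carry
-- trailing zeros and why conjugation takes place in a fixed box; the zeros are stripped only when a
-- minor is compared with a Schur polynomial of the original definition or with a top coefficient.

CRing : Set₁
CRing = CommutativeRing 0ℓ 0ℓ

-- Formal power series

module PowerSeries (R : CRing) where
  open CommutativeRing R
  open SetoidReasoning setoid

  Series : Set
  Series = ℕ → Carrier

  tl : Series → Series
  tl f n = f (suc n)

  infix 4 _≋_
  _≋_ : Series → Series → Set
  f ≋ g = ∀ n → f n ≈ g n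

  infixl 7 _⊛_
  _⊛_ : Series → Series → Series
  (f ⊛ g) zero    = f 0 * g 0
  (f ⊛ g) (suc n) = f 0 * g (suc n) + (tl f ⊛ g) n

  monomial : Carrier → ℕ → Series
  monomial a zero    zero    = a
  monomial a zero    (suc n) = 0#
  monomial a (suc e) zero    = 0#
  monomial a (suc e) (suc n) = monomial a e n

  const : Carrier → Series
  const a = monomial a 0

  ⊛-cong : ∀ {f f′ g g′} → f ≋ f′ → g ≋ g′ → f ⊛ g ≋ f′ ⊛ g′
  ⊛-cong p q zero    = *-cong (p 0) (q 0)
  ⊛-cong p q (suc n) = +-cong (*-cong (p 0) (q (suc n))) (⊛-cong (λ i → p (suc i)) q n)

  ⊛-distribʳ : ∀ h f g → (λ i → f i + g i) ⊛ h ≋ λ i → (f ⊛ h) i + (g ⊛ h) i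
  ⊛-distribʳ h f g zero    = distribʳ (h 0) (f 0) (g 0)
  ⊛-distribʳ h f g (suc n) =
    trans (+-cong (distribʳ _ _ _) (⊛-distribʳ h (tl f) (tl g) n))
          (interchange +-commutativeSemigroup _ _ _ _)

  ⊛-scale : ∀ k f g → (λ i → k * f i) ⊛ g ≋ λ i → k * (f ⊛ g) i
  ⊛-scale k f g zero    = *-assoc _ _ _
  ⊛-scale k f g (suc n) =
    trans (+-cong (*-assoc _ _ _) (⊛-scale k (tl f) g n)) (sym (distribˡ _ _ _))

  ⊛-zeroˡ : ∀ f g → (∀ n → f n ≈ 0#) → ∀ n → (f ⊛ g) n ≈ 0#
  ⊛-zeroˡ f g p zero    = trans (*-congʳ (p 0)) (zeroˡ _)
  ⊛-zeroˡ f g p (suc n) =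
    trans (+-cong (trans (*-congʳ (p 0)) (zeroˡ _)) (⊛-zeroˡ (tl f) g (λ i → p (suc i)) n))
          (+-identityˡ 0#)

  ⊛-constˡ : ∀ f g → (∀ n → f (suc n) ≈ 0#) → ∀ n → (f ⊛ g) n ≈ f 0 * g n
  ⊛-constˡ f g p zero    = refl
  ⊛-constˡ f g p (suc n) = trans (+-congˡ (⊛-zeroˡ (tl f) g p n)) (+-identityʳ _)

  -- The definition of `⊛` splits off the constant term of the left factor. This is the mirror image
  -- for the right factor, from which commutativity follows.
  ⊛-suc : ∀ f g n → (f ⊛ g) (suc n) ≈ f (suc n) * g 0 + (f ⊛ tl g) n
  ⊛-suc f g zero    = +-comm _ _
  ⊛-suc f g (suc n) =
    trans (+-congˡ (⊛-suc (tl f) g n)) (x∙yz≈y∙xz +-commutativeSemigroup _ _ _)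

  ⊛-comm : ∀ f g → f ⊛ g ≋ g ⊛ f
  ⊛-comm f g zero    = *-comm _ _
  ⊛-comm f g (suc n) =
    trans (+-cong (*-comm _ _) (⊛-comm (tl f) g n)) (sym (⊛-suc g f n))

  ⊛-assoc : ∀ f g h → (f ⊛ g) ⊛ h ≋ f ⊛ (g ⊛ h)
  ⊛-assoc f g h zero    = *-assoc _ _ _
  ⊛-assoc f g h (suc n) = begin
    f 0 * g 0 * h (suc n) + (tl (f ⊛ g) ⊛ h) n
      ≈⟨ +-cong (*-assoc _ _ _)
           (trans (⊛-distribʳ h (λ i → f 0 * g (suc i)) (tl f ⊛ g) n)
                  (+-cong (⊛-scale (f 0) (tl g) h n) (⊛-assoc (tl f) g h n))) ⟩
    f 0 * (g 0 * h (suc n)) + (f 0 * (tl g ⊛ h) n + (tl f ⊛ (g ⊛ h)) n)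
      ≈⟨ sym (+-assoc _ _ _) ⟩
    f 0 * (g 0 * h (suc n)) + f 0 * (tl g ⊛ h) n + (tl f ⊛ (g ⊛ h)) n
      ≈⟨ +-congʳ (sym (distribˡ _ _ _)) ⟩
    f 0 * (g ⊛ h) (suc n) + (tl f ⊛ (g ⊛ h)) n ∎

  ⊛-identityˡ : ∀ f → const 1# ⊛ f ≋ f
  ⊛-identityˡ f n = trans (⊛-constˡ (const 1#) f (λ _ → refl) n) (*-identityˡ _)

  seriesRing : CRing
  seriesRing = record
    { Carrier = Series
    ; _≈_ = _≋_
    ; _+_ = λ f g n → f n + g n
    ; _*_ = _⊛_
    ; -_ = λ f n → - f n
    ; 0# = λ _ → 0#
    ; 1# = const 1#
    ; isCommutativeRing = record
      { isRing = record
        { +-isAbelianGroup = Pointwise.isAbelianGroup ℕ +-isAbelianGroup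
        ; *-cong = ⊛-cong
        ; *-assoc = ⊛-assoc
        ; *-identity = ⊛-identityˡ , λ f n → trans (⊛-comm f (const 1#) n) (⊛-identityˡ f n)
        ; distrib = (λ f g h n → trans (⊛-comm f (λ i → g i + h i) n)
                       (trans (⊛-distribʳ f g h n) (+-cong (⊛-comm g f n) (⊛-comm h f n))))
                  , ⊛-distribʳ
        }
      ; *-comm = ⊛-comm
      }
    }

  -- The indeterminate. In the converse it plays t in one place and the variable z₁ in another.
  X : Series
  X = monomial 1# 1

  X⊛-suc : ∀ f n → (X ⊛ f) (suc n) ≈ f n
  X⊛-suc f n = trans (+-cong (zeroˡ _) (⊛-identityˡ f n)) (+-identityˡ _)

  const-* : ∀ a b → const (a * b) ≋ const a ⊛ const b
  const-* a b zero    = refl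
  const-* a b (suc n) = sym (trans (⊛-constˡ (const a) (const b) (λ _ → refl) (suc n)) (zeroʳ _))

  const-+ : ∀ a b → const (a + b) ≋ λ n → const a n + const b n
  const-+ a b zero    = refl
  const-+ a b (suc n) = sym (+-identityˡ _)

  const-cong : ∀ {a b} → a ≈ b → const a ≋ const b
  const-cong p zero    = p
  const-cong p (suc n) = refl

  const-0 : ∀ n → const 0# n ≈ 0#
  const-0 zero    = refl
  const-0 (suc n) = refl

  const-neg : ∀ a → const (- a) ≋ λ n → - const a n
  const-neg a zero    = refl
  const-neg a (suc n) = sym (RingProperties.-0#≈0# (CommutativeRing.ring R))

-- Generating series of the (hook) complete symmetric polynomials

module Generating (R : CRing) where
  open CommutativeRing R
  open PowerSeries R
  open RingProperties (CommutativeRing.ring R) using (-‿distribˡ-*)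
  module S = CommutativeRing (PowerSeries.seriesRing R)

  -- As a coefficient sequence this is the geometric series 1/(1 - yz), and `lin y` below is 1 + yz.
  -- Hence `hs` lists the complete homogeneous and `lins` the elementary symmetric polynomials.
  pow : Carrier → ℕ → Carrier
  pow y zero    = 1#
  pow y (suc n) = y * pow y n

  lin : Carrier → Series
  lin y zero          = 1#
  lin y (suc zero)    = y
  lin y (suc (suc n)) = 0#

  lins : List Carrier → Series
  lins []       = S.1#
  lins (y ∷ ys) = lin y ⊛ lins ys

  hs : List Carrier → Series
  hs []       = S.1#
  hs (y ∷ ys) = pow y ⊛ hs ys

  lin⊛-zero : ∀ y g → (lin y ⊛ g) 0 ≈ g 0
  lin⊛-zero y g = *-identityˡ _

  lin⊛-suc : ∀ y g n → (lin y ⊛ g) (suc n) ≈ g (suc n) + y * g n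
  lin⊛-suc y g n = +-cong (*-identityˡ _) (⊛-constˡ (tl (lin y)) g (λ _ → refl) n)

  lin-pow : ∀ y → lin (- y) ⊛ pow y ≋ S.1#
  lin-pow y zero    = *-identityˡ _
  lin-pow y (suc n) = trans (lin⊛-suc (- y) (pow y) n)
    (trans (+-congˡ (sym (-‿distribˡ-* _ _))) (-‿inverseʳ _))

  lin-pow′ : ∀ y → lin y ⊛ pow (- y) ≋ S.1#
  lin-pow′ y zero    = *-identityˡ _
  lin-pow′ y (suc n) = trans (lin⊛-suc y (pow (- y)) n)
    (trans (+-congʳ (sym (-‿distribˡ-* _ _))) (-‿inverseˡ _))

  pow-0 : pow 0# ≋ S.1#
  pow-0 zero    = refl
  pow-0 (suc n) = zeroˡ _

  hs-0 : ∀ ys → hs ys 0 ≈ 1#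
  hs-0 []       = refl
  hs-0 (y ∷ ys) = trans (*-identityˡ _) (hs-0 ys)

  hs-++ : ∀ xs ys → hs (xs ++ ys) ≋ hs xs ⊛ hs ys
  hs-++ []       ys = S.sym (⊛-identityˡ (hs ys))
  hs-++ (x ∷ xs) ys = S.trans (⊛-cong S.refl (hs-++ xs ys)) (S.sym (⊛-assoc (pow x) (hs xs) (hs ys)))

-- Sums over lists

module Sums (R : CRing) where
  open CommutativeRing R

  Sum : {A : Set} → List A → (A → Carrier) → Carrier
  Sum []       f = 0#
  Sum (x ∷ xs) f = f x + Sum xs f

  module _ {A : Set} where

    Sum-cong∈ : (xs : List A) {f g : A → Carrier} →
      (∀ {x} → x ∈ xs → f x ≈ g x) → Sum xs f ≈ Sum xs g
    Sum-cong∈ []       p = refl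
    Sum-cong∈ (x ∷ xs) p = +-cong (p (here ≡.refl)) (Sum-cong∈ xs (λ m → p (there m)))

    Sum-cong : (xs : List A) {f g : A → Carrier} → (∀ x → f x ≈ g x) → Sum xs f ≈ Sum xs g
    Sum-cong xs p = Sum-cong∈ xs (λ {x} _ → p x)

    Sum-0 : (xs : List A) {f : A → Carrier} → (∀ {x} → x ∈ xs → f x ≈ 0#) → Sum xs f ≈ 0#
    Sum-0 []       p = refl
    Sum-0 (x ∷ xs) p =
      trans (+-cong (p (here ≡.refl)) (Sum-0 xs (λ m → p (there m)))) (+-identityˡ 0#)

    Sum-+ : (xs : List A) (f g : A → Carrier) → Sum xs (λ x → f x + g x) ≈ Sum xs f + Sum xs g
    Sum-+ []       f g = sym (+-identityˡ 0#)
    Sum-+ (x ∷ xs) f g =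
      trans (+-congˡ (Sum-+ xs f g)) (interchange +-commutativeSemigroup _ _ _ _)

    Sum-scale : (xs : List A) (k : Carrier) (f : A → Carrier) →
      Sum xs (λ x → k * f x) ≈ k * Sum xs f
    Sum-scale []       k f = sym (zeroʳ k)
    Sum-scale (x ∷ xs) k f = trans (+-congˡ (Sum-scale xs k f)) (sym (distribˡ _ _ _))

    Sum-++ : (xs ys : List A) (f : A → Carrier) → Sum (xs ++ ys) f ≈ Sum xs f + Sum ys f
    Sum-++ []       ys f = sym (+-identityˡ _)
    Sum-++ (x ∷ xs) ys f = trans (+-congˡ (Sum-++ xs ys f)) (sym (+-assoc _ _ _))

    Sum-↭ : {xs ys : List A} (f : A → Carrier) → xs ↭ ys → Sum xs f ≈ Sum ys f
    Sum-↭ f Perm.refl          = refl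
    Sum-↭ f (Perm.prep x p)    = +-congˡ (Sum-↭ f p)
    Sum-↭ f (Perm.swap x y p)  =
      trans (x∙yz≈y∙xz +-commutativeSemigroup _ _ _) (+-congˡ (+-congˡ (Sum-↭ f p)))
    Sum-↭ f (Perm.trans p q)   = trans (Sum-↭ f p) (Sum-↭ f q)

    Sum-single : {xs : List A} {x : A} (f : A → Carrier) → Unique xs → x ∈ xs →
      (∀ {y} → y ∈ xs → y ≢ x → f y ≈ 0#) → Sum xs f ≈ f x
    Sum-single {x ∷ xs} f (x∉xs ∷ _) (here ≡.refl) p =
      trans (+-congˡ (Sum-0 xs (λ m → p (there m) (λ e → All.lookup x∉xs m (≡.sym e)))))
            (+-identityʳ _)
    Sum-single {y ∷ xs} f (y∉xs ∷ u) (there m) p =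
      trans (+-cong (p (here ≡.refl) (All.lookup y∉xs m)) (Sum-single f u m (λ m′ → p (there m′))))
            (+-identityˡ _)

  module _ {A B : Set} where

    Sum-map : (h : A → B) (xs : List A) (f : B → Carrier) →
      Sum (map h xs) f ≈ Sum xs (λ x → f (h x))
    Sum-map h []       f = refl
    Sum-map h (x ∷ xs) f = +-congˡ (Sum-map h xs f)

    Sum-swap : (xs : List A) (ys : List B) (f : A → B → Carrier) →
      Sum xs (λ x → Sum ys (f x)) ≈ Sum ys (λ y → Sum xs (λ x → f x y))
    Sum-swap []       ys f = sym (Sum-0 ys (λ _ → refl))
    Sum-swap (x ∷ xs) ys f = trans (+-congˡ (Sum-swap xs ys f))
      (sym (Sum-+ ys (f x) (λ y → Sum xs (λ x′ → f x′ y))))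

  Sum-filter : {A : Set} {P : A → Set} (P? : Decidable P) (xs : List A) {f : A → Carrier} →
    (∀ {x} → x ∈ xs → ¬ P x → f x ≈ 0#) → Sum (filter P? xs) f ≈ Sum xs f
  Sum-filter P? []       p = refl
  Sum-filter P? (x ∷ xs) p with P? x
  ... | yes q = +-congˡ (Sum-filter P? xs (λ m → p (there m)))
  ... | no ¬q = trans (Sum-filter P? xs (λ m → p (there m)))
    (sym (trans (+-congʳ (p (here ≡.refl) ¬q)) (+-identityˡ _)))

  Sum-cartesian : {A B C : Set} (h : A → B → C) (xs : List A) (ys : List B) (f : C → Carrier) →
    Sum (cartesianProductWith h xs ys) f ≈ Sum xs (λ x → Sum ys (λ y → f (h x y)))
  Sum-cartesian h []       ys f = refl
  Sum-cartesian h (x ∷ xs) ys f = trans (Sum-++ (map (h x) ys) _ f)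
    (+-cong (Sum-map (h x) ys f) (Sum-cartesian h xs ys f))

-- Minors, expanded along their first row

module Minors (R : CRing) where
  open CommutativeRing R
  open RingProperties (CommutativeRing.ring R)
    using (-‿distribʳ-*; -‿+-comm; -0#≈0#; -‿involutive; ⁻¹-anti-homo‿-)
  open Sums R
  open SetoidReasoning setoid

  private
    variable
      C : Set

  -- The recursion is on the list of columns, so that the alternating property
  -- below needs no bookkeeping of signs.
  E : (C → Carrier) → (List C → Carrier) → List C → Carrier
  E r F []       = 0#
  E r F (c ∷ cs) = r c * F cs + - E r (λ ds → F (c ∷ ds)) cs

  -- The value 0 for lists of different lengths lets the expansion identities hold for all lists of
  -- columns.
  D : (ℕ → C → Carrier) → List ℕ → List C → Carrier
  D a []       []      = 1#
  D a []       (_ ∷ _) = 0#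
  D a (p ∷ ps) cs      = E (a p) (D a ps) cs

  E-cong : {r r′ : C → Carrier} {F F′ : List C → Carrier} →
    (∀ c → r c ≈ r′ c) → (∀ cs → F cs ≈ F′ cs) → ∀ cs → E r F cs ≈ E r′ F′ cs
  E-cong p q []       = refl
  E-cong p q (c ∷ cs) =
    +-cong (*-cong (p c) (q cs)) (-‿cong (E-cong p (λ ds → q (c ∷ ds)) cs))

  D-cong : {a b : ℕ → C → Carrier} → (∀ p c → a p c ≈ b p c) →
    ∀ ps cs → D a ps cs ≈ D b ps cs
  D-cong q []       []      = refl
  D-cong q []       (_ ∷ _) = refl
  D-cong q (p ∷ ps) cs      = E-cong (q p) (D-cong q ps) cs

  private
    +-neg-interchange : ∀ w x y z → (w + x) + - (y + z) ≈ (w + - y) + (x + - z)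
    +-neg-interchange w x y z =
      trans (+-congˡ (sym (-‿+-comm y z))) (interchange +-commutativeSemigroup _ _ _ _)

    *-neg-distribˡ : ∀ k x y → k * x + - (k * y) ≈ k * (x + - y)
    *-neg-distribˡ k x y = trans (+-congˡ (-‿distribʳ-* k y)) (sym (distribˡ k x (- y)))

  E-+ˡ : (r s : C → Carrier) (F : List C → Carrier) → ∀ cs →
    E (λ c → r c + s c) F cs ≈ E r F cs + E s F cs
  E-+ˡ r s F []       = sym (+-identityˡ 0#)
  E-+ˡ r s F (c ∷ cs) =
    trans (+-cong (distribʳ _ _ _) (-‿cong (E-+ˡ r s (λ ds → F (c ∷ ds)) cs)))
          (+-neg-interchange _ _ _ _)

  E-scaleˡ : (k : Carrier) (r : C → Carrier) (F : List C → Carrier) → ∀ cs →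
    E (λ c → k * r c) F cs ≈ k * E r F cs
  E-scaleˡ k r F []       = sym (zeroʳ k)
  E-scaleˡ k r F (c ∷ cs) =
    trans (+-cong (*-assoc _ _ _) (-‿cong (E-scaleˡ k r (λ ds → F (c ∷ ds)) cs)))
          (*-neg-distribˡ _ _ _)

  E-+ʳ : (r : C → Carrier) (F G : List C → Carrier) → ∀ cs →
    E r (λ ds → F ds + G ds) cs ≈ E r F cs + E r G cs
  E-+ʳ r F G []       = sym (+-identityˡ 0#)
  E-+ʳ r F G (c ∷ cs) =
    trans (+-cong (distribˡ _ _ _) (-‿cong (E-+ʳ r (λ ds → F (c ∷ ds)) (λ ds → G (c ∷ ds)) cs)))
          (+-neg-interchange _ _ _ _)

  E-scaleʳ : (k : Carrier) (r : C → Carrier) (F : List C → Carrier) → ∀ cs →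
    E r (λ ds → k * F ds) cs ≈ k * E r F cs
  E-scaleʳ k r F []       = sym (zeroʳ k)
  E-scaleʳ k r F (c ∷ cs) =
    trans (+-cong (trans (sym (*-assoc _ _ _)) (trans (*-congʳ (*-comm _ _)) (*-assoc _ _ _)))
                  (-‿cong (E-scaleʳ k r (λ ds → F (c ∷ ds)) cs)))
          (*-neg-distribˡ _ _ _)

  E-0ˡ : {r : C → Carrier} (F : List C → Carrier) → (∀ c → r c ≈ 0#) → ∀ cs → E r F cs ≈ 0#
  E-0ˡ {r = r} F p cs = begin
    E r F cs                ≈⟨ E-cong (λ c → trans (p c) (sym (zeroˡ 0#))) (λ _ → refl) cs ⟩
    E (λ c → 0# * 0#) F cs  ≈⟨ E-scaleˡ 0# (λ _ → 0#) F cs ⟩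
    0# * E (λ _ → 0#) F cs  ≈⟨ zeroˡ _ ⟩
    0# ∎

  E-negʳ : (r : C → Carrier) (F : List C → Carrier) → ∀ cs →
    E r (λ ds → - F ds) cs ≈ - E r F cs
  E-negʳ r F []       = sym -0#≈0#
  E-negʳ r F (c ∷ cs) =
    trans (+-cong (sym (-‿distribʳ-* _ _)) (-‿cong (E-negʳ r (λ ds → F (c ∷ ds)) cs)))
          (-‿+-comm _ _)

  -- `P` is a condition on single columns because the expansion only deletes columns: what holds for
  -- every column of `cs` holds on every list at which `F` is evaluated.
  E-0On : {P : C → Set} (r : C → Carrier) (F : List C → Carrier) →
    (∀ {ds} → All P ds → F ds ≈ 0#) → ∀ {cs} → All P cs → E r F cs ≈ 0#
  E-0On r F p []              = refl
  E-0On r F p {c ∷ cs} (q ∷ qs) =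
    trans (+-cong (trans (*-congˡ (p qs)) (zeroʳ _))
                  (-‿cong (E-0On r (λ ds → F (c ∷ ds)) (λ q′ → p (q ∷ q′)) qs)))
          (trans (+-identityˡ _) -0#≈0#)

  -- Split according to which of the two rows takes the column c. If neither does, two sign changes
  -- cancel and the same double expansion remains over fewer columns; the other terms form a
  -- difference that is antisymmetric in r and s.
  E-E : (r s : C → Carrier) (F : List C → Carrier) → ∀ c cs →
    E r (E s F) (c ∷ cs)
      ≈ (r c * E s F cs + - (s c * E r F cs)) + E r (E s (λ ds → F (c ∷ ds))) cs
  E-E r s F c cs = begin
    r c * E s F cs + - E r (λ ds → s c * F ds + - E s F′ ds) cs
      ≈⟨ +-congˡ (-‿cong (E-+ʳ r (λ ds → s c * F ds) (λ ds → - E s F′ ds) cs)) ⟩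
    r c * E s F cs + - (E r (λ ds → s c * F ds) cs + E r (λ ds → - E s F′ ds) cs)
      ≈⟨ +-congˡ (-‿cong (+-cong (E-scaleʳ (s c) r F cs) (E-negʳ r (E s F′) cs))) ⟩
    r c * E s F cs + - (s c * E r F cs + - E r (E s F′) cs)
      ≈⟨ +-congˡ (trans (sym (-‿+-comm _ _)) (+-congˡ (-‿involutive _))) ⟩
    r c * E s F cs + (- (s c * E r F cs) + E r (E s F′) cs)
      ≈⟨ sym (+-assoc _ _ _) ⟩
    (r c * E s F cs + - (s c * E r F cs)) + E r (E s F′) cs ∎
    where F′ = λ ds → F (c ∷ ds)

  -- Proved separately from `E-anticomm`, which would only show that twice this value is zero; 2
  -- need not be cancellable in R.
  E-alternating : (r : C → Carrier) (F : List C → Carrier) → ∀ cs → E r (E r F) cs ≈ 0#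
  E-alternating r F []       = refl
  E-alternating r F (c ∷ cs) = trans (E-E r r F c cs)
    (trans (+-cong (-‿inverseʳ _) (E-alternating r (λ ds → F (c ∷ ds)) cs)) (+-identityˡ 0#))

  E-anticomm : (r s : C → Carrier) (F : List C → Carrier) → ∀ cs →
    E r (E s F) cs ≈ - E s (E r F) cs
  E-anticomm r s F []       = sym -0#≈0#
  E-anticomm r s F (c ∷ cs) = begin
    E r (E s F) (c ∷ cs)
      ≈⟨ E-E r s F c cs ⟩
    (r c * E s F cs + - (s c * E r F cs)) + E r (E s F′) cs
      ≈⟨ +-cong (sym (⁻¹-anti-homo‿- _ _)) (E-anticomm r s F′ cs) ⟩
    - (s c * E r F cs + - (r c * E s F cs)) + - E s (E r F′) cs
      ≈⟨ -‿+-comm _ _ ⟩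
    - ((s c * E r F cs + - (r c * E s F cs)) + E s (E r F′) cs)
      ≈⟨ -‿cong (sym (E-E s r F c cs)) ⟩
    - E s (E r F) (c ∷ cs) ∎
    where F′ = λ ds → F (c ∷ ds)

  E-Sumʳ : {A : Set} (xs : List A) (w : A → Carrier) (r : C → Carrier)
    (F : A → List C → Carrier) → ∀ cs →
    E r (λ ds → Sum xs (λ x → w x * F x ds)) cs ≈ Sum xs (λ x → w x * E r (F x) cs)
  E-Sumʳ []       w r F cs = E-0On r (λ _ → 0#) (λ _ → refl) (All.universal (λ c → ≡.refl {x = c}) cs)
  E-Sumʳ (x ∷ xs) w r F cs = trans (E-+ʳ r (λ ds → w x * F x ds) _ cs)
    (+-cong (E-scaleʳ (w x) r (F x) cs) (E-Sumʳ xs w r F cs))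

  E-Sumˡ : {A : Set} (xs : List A) (w : A → Carrier) (r : A → C → Carrier)
    (F : List C → Carrier) → ∀ cs →
    E (λ c → Sum xs (λ x → w x * r x c)) F cs ≈ Sum xs (λ x → w x * E (r x) F cs)
  E-Sumˡ []       w r F cs = E-0ˡ F (λ _ → refl) cs
  E-Sumˡ (x ∷ xs) w r F cs = trans (E-+ˡ (λ c → w x * r x c) _ F cs)
    (+-cong (E-scaleˡ (w x) (r x) F cs) (E-Sumˡ xs w r F cs))

  E-0row : (r : C → Carrier) (F : List C → Carrier) → ∀ {cs} → All (λ c → r c ≈ 0#) cs → E r F cs ≈ 0#
  E-0row r F []              = refl
  E-0row r F {c ∷ cs} (p ∷ ps) =
    trans (+-cong (trans (*-congʳ p) (zeroˡ _)) (-‿cong (E-0row r (λ ds → F (c ∷ ds)) ps)))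
          (trans (+-identityˡ _) -0#≈0#)

  D-0col : (a : ℕ → C → Carrier) (c : C) → ∀ {ps} → All (λ p → a p c ≈ 0#) ps → ∀ cs → D a ps (c ∷ cs) ≈ 0#
  D-0col a c []             cs = refl
  D-0col a c {p ∷ ps} (q ∷ qs) cs =
    trans (+-cong (trans (*-congʳ q) (zeroˡ _))
                  (-‿cong (E-0On (a p) (λ ds → D a ps (c ∷ ds)) (λ {ds} _ → D-0col a c qs ds)
                            (All.universal {P = λ _ → ⊤} (λ _ → tt) cs))))
          (trans (+-identityˡ _) -0#≈0#)

  D-0row : (a : ℕ → C → Carrier) (q : ℕ) → ∀ ps {cs} →
    All (λ c → a q c ≈ 0#) cs → D a (ps ++ q ∷ []) cs ≈ 0#
  D-0row a q []       h = E-0row (a q) (D a []) h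
  D-0row a q (p ∷ ps) h = E-0On (a p) (D a (ps ++ q ∷ [])) (D-0row a q ps) h

-- Partitions, possibly with trailing zeros

module Partitions where
  open import Data.Nat.Properties
  open ≡ using (refl; sym; trans; cong; cong₂; subst)

  Decr : List ℕ → Set
  Decr L = ∀ i → part L (suc i) ≤ part L i

  decr-∷ : ∀ {l ls} → part ls 0 ≤ l → Decr ls → Decr (l ∷ ls)
  decr-∷ p d zero    = p
  decr-∷ p d (suc i) = d i

  decr-tail : ∀ {l ls} → Decr (l ∷ ls) → Decr ls
  decr-tail d i = d (suc i)

  decr-≤head : ∀ L → Decr L → ∀ i → part L i ≤ part L 0
  decr-≤head L d zero    = ≤-refl
  decr-≤head L d (suc i) = ≤-trans (d i) (decr-≤head L d i)

  part-ext : ∀ xs ys → length xs ≡ length ys → (∀ i → part xs i ≡ part ys i) → xs ≡ ys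
  part-ext []       []       e p = refl
  part-ext (x ∷ xs) (y ∷ ys) e p =
    cong₂ _∷_ (p 0) (part-ext xs ys (suc-injective e) (λ i → p (suc i)))

  part-beyond : ∀ xs {i} → length xs ≤ i → part xs i ≡ 0
  part-beyond []       p = refl
  part-beyond (x ∷ xs) (s≤s p) = part-beyond xs p

  part-< : ∀ xs {i x} → x < part xs i → i < length xs
  part-< xs {i} {x} p with i <? length xs
  ... | yes q = q
  ... | no ¬q with () ← subst (x <_) (part-beyond xs (≮⇒≥ ¬q)) p

  sum-mono : ∀ xs ys → length xs ≡ length ys → (∀ i → part xs i ≤ part ys i) → sum xs ≤ sum ys
  sum-mono []       []       e p = z≤n
  sum-mono (x ∷ xs) (y ∷ ys) e p = +-mono-≤ (p 0) (sum-mono xs ys (suc-injective e) (λ i → p (suc i)))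

  -- Numbers are compared through their initial segments. A part of a conjugate is best known
  -- through the x below it, so inequalities between such parts are obtained this way.
  ≤-ext : ∀ {a b} → (∀ {x} → x < a → x < b) → a ≤ b
  ≤-ext {zero}  p = z≤n
  ≤-ext {suc a} p = p ≤-refl

  -- Conjugation inside a box

  cnt : ℕ → List ℕ → ℕ
  cnt j L = length (filter (λ x → suc j ℕ.≤? x) L)

  -- Unlike `conj`, this always has M entries, so the conjugates of all μ inside λ index minors of
  -- one size.
  cj : ℕ → List ℕ → List ℕ
  cj M L = map (λ j → cnt j L) (upTo M)

  part-applyUpTo : ∀ (f : ℕ → ℕ) M {j} → j < M → part (applyUpTo f M) j ≡ f j
  part-applyUpTo f (suc M) {zero}  p = refl
  part-applyUpTo f (suc M) {suc j} (s≤s p) = part-applyUpTo (λ i → f (suc i)) M p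

  length-cj : ∀ M L → length (cj M L) ≡ M
  length-cj M L = trans (cong length (map-upTo (λ j → cnt j L) M)) (length-applyUpTo (λ j → cnt j L) M)

  part-cj : ∀ M L {j} → j < M → part (cj M L) j ≡ cnt j L
  part-cj M L {j} p = trans (cong (λ xs → part xs j) (map-upTo (λ j → cnt j L) M)) (part-applyUpTo (λ j → cnt j L) M p)

  cnt-accept : ∀ {j k} ks → j < k → cnt j (k ∷ ks) ≡ suc (cnt j ks)
  cnt-accept {j} ks p = cong length (filter-accept (λ x → suc j ℕ.≤? x) p)

  cnt-reject : ∀ {j k} ks → ¬ j < k → cnt j (k ∷ ks) ≡ cnt j ks
  cnt-reject {j} ks p = cong length (filter-reject (λ x → suc j ℕ.≤? x) p)

  cnt-small : ∀ {j} L → (∀ i → part L i ≤ j) → cnt j L ≡ 0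
  cnt-small []       p = refl
  cnt-small (k ∷ ks) p = trans (cnt-reject ks (≤⇒≯ (p 0))) (cnt-small ks (λ i → p (suc i)))

  <cnt⇒ : ∀ {L i j} → Decr L → i < cnt j L → j < part L i
  <cnt⇒ {k ∷ ks} {i} {j} d p with j <? k
  <cnt⇒ {k ∷ ks} {zero}  {j} d p | yes q = q
  <cnt⇒ {k ∷ ks} {suc i} {j} d p | yes q =
    <cnt⇒ {ks} (decr-tail d) (s≤s⁻¹ (subst (suc i <_) (cnt-accept ks q) p))
  ... | no ¬q with () ← subst (i <_) (cnt-small (k ∷ ks) (λ i → ≤-trans (decr-≤head (k ∷ ks) d i) (≮⇒≥ ¬q))) p

  ⇒<cnt : ∀ {L i j} → Decr L → j < part L i → i < cnt j L
  ⇒<cnt {k ∷ ks} {zero}  {j} d p = subst (0 <_) (sym (cnt-accept ks p)) (s≤s z≤n)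
  ⇒<cnt {k ∷ ks} {suc i} {j} d p =
    subst (suc i <_) (sym (cnt-accept ks (<-≤-trans p (decr-≤head (k ∷ ks) d (suc i)))))
          (s≤s (⇒<cnt {ks} (decr-tail d) p))

  module _ {M : ℕ} {κ : List ℕ} (d : Decr κ) where

    -- Transposition of a single cell. Together with its converse it replaces counting in the lemmas
    -- on conjugate strips.
    <part-cj⇒ : ∀ {x j} → x < part (cj M κ) j → j < M × j < part κ x
    <part-cj⇒ {x} {j} p = j<M , <cnt⇒ {κ} d (subst (x <_) (part-cj M κ j<M) p)
      where j<M = subst (j <_) (length-cj M κ) (part-< (cj M κ) p)

    ⇒<part-cj : ∀ {x j} → j < M → j < part κ x → x < part (cj M κ) j
    ⇒<part-cj {x} j<M p = subst (x <_) (sym (part-cj M κ j<M)) (⇒<cnt {κ} d p)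

    cj-decr : Decr (cj M κ)
    cj-decr j = ≤-ext λ p → let j<M , q = <part-cj⇒ p in
      ⇒<part-cj (<-trans (n<1+n j) j<M) (<-trans (n<1+n j) q)

  cj-bounded : ∀ {M κ} → Decr κ → ∀ j → part (cj M κ) j ≤ length κ
  cj-bounded {M} {κ} d j = ≤-ext λ p → part-< κ (proj₂ (<part-cj⇒ {M} {κ} d p))

  cj-involutive : ∀ {N M κ} → Decr κ → length κ ≡ N → (∀ i → part κ i ≤ M) → cj N (cj M κ) ≡ κ
  cj-involutive {N} {M} {κ} d e b = part-ext _ _ (trans (length-cj N (cj M κ)) (sym e)) λ i → ≤-antisym
    (≤-ext λ p → proj₂ (<part-cj⇒ {M} {κ} d (proj₂ (<part-cj⇒ {N} {cj M κ} d′ p))))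
    (≤-ext λ p → ⇒<part-cj {N} {cj M κ} d′ (subst (i <_) e (part-< κ p))
                   (⇒<part-cj {M} {κ} d (<-≤-trans p (b i)) p))
    where d′ = cj-decr {M} {κ} d

  cj-injective : ∀ {M κ μ} → Decr κ → Decr μ → (∀ i → part κ i ≤ M) → (∀ i → part μ i ≤ M) →
    cj M κ ≡ cj M μ → ∀ i → part κ i ≡ part μ i
  cj-injective {M} {κ} {μ} dκ dμ bκ bμ e i = ≤-antisym (≤-ext (go κ μ dκ dμ bκ e)) (≤-ext (go μ κ dμ dκ bμ (sym e)))
    where
    go : ∀ κ μ {x} → Decr κ → Decr μ → (∀ i → part κ i ≤ M) → cj M κ ≡ cj M μ →
      x < part κ i → x < part μ i
    go κ μ {x} dκ dμ bκ e p = proj₂ (<part-cj⇒ {M} {μ} dμ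
      (subst (λ α → i < part α x) e (⇒<part-cj {M} {κ} dκ (<-≤-trans p (bκ i)) p)))

  sum-applyUpTo-+ : ∀ (f g : ℕ → ℕ) M →
    sum (applyUpTo (λ j → f j ℕ.+ g j) M) ≡ sum (applyUpTo f M) ℕ.+ sum (applyUpTo g M)
  sum-applyUpTo-+ f g zero    = refl
  sum-applyUpTo-+ f g (suc M) rewrite sum-applyUpTo-+ (λ i → f (suc i)) (λ i → g (suc i)) M =
    interchange +-commutativeSemigroup (f 0) (g 0) _ _

  sum-applyUpTo-0 : ∀ M → sum (applyUpTo (λ _ → 0) M) ≡ 0
  sum-applyUpTo-0 zero    = refl
  sum-applyUpTo-0 (suc M) = sum-applyUpTo-0 M

  below : ℕ → ℕ → ℕ
  below zero    j       = 0
  below (suc k) zero    = 1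
  below (suc k) (suc j) = below k j

  sum-below : ∀ {k M} → k ≤ M → sum (applyUpTo (below k) M) ≡ k
  sum-below {zero}  {M} p             = sum-applyUpTo-0 M
  sum-below {suc k} {suc M} (s≤s p) = cong suc (sum-below p)

  below-yes : ∀ {j k} → j < k → below k j ≡ 1
  below-yes {zero}  (s≤s p) = refl
  below-yes {suc j} (s≤s p) = below-yes p

  below-no : ∀ {k j} → k ≤ j → below k j ≡ 0
  below-no z≤n     = refl
  below-no (s≤s p) = below-no p

  cnt-∷ : ∀ j k ks → cnt j (k ∷ ks) ≡ below k j ℕ.+ cnt j ks
  cnt-∷ j k ks with j <? k
  ... | yes p = trans (cnt-accept ks p) (cong (ℕ._+ cnt j ks) (sym (below-yes p)))
  ... | no ¬p = trans (cnt-reject ks ¬p) (cong (ℕ._+ cnt j ks) (sym (below-no (≮⇒≥ ¬p))))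

  applyUpTo-cong : ∀ {f g : ℕ → ℕ} → (∀ j → f j ≡ g j) → ∀ M → applyUpTo f M ≡ applyUpTo g M
  applyUpTo-cong p zero    = refl
  applyUpTo-cong p (suc M) = cong₂ _∷_ (p 0) (applyUpTo-cong (λ j → p (suc j)) M)

  -- Cells are counted by columns instead of rows: a row of length k meets exactly the columns j <
  -- k, and these lie in the box since k ≤ M.
  sum-cj : ∀ M κ → (∀ i → part κ i ≤ M) → sum (cj M κ) ≡ sum κ
  sum-cj M κ b = trans (cong sum (map-upTo (λ j → cnt j κ) M)) (go κ b)
    where
    go : ∀ κ → (∀ i → part κ i ≤ M) → sum (applyUpTo (λ j → cnt j κ) M) ≡ sum κ
    go []       b = sum-applyUpTo-0 M
    go (k ∷ ks) b = trans (cong sum (applyUpTo-cong (λ j → cnt-∷ j k ks) M))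
      (trans (sum-applyUpTo-+ (below k) (λ j → cnt j ks) M)
             (cong₂ ℕ._+_ (sum-below (b 0)) (go ks (λ i → b (suc i)))))

  -- Horizontal and vertical strips

  down : ℕ → ℕ → List ℕ
  down zero    b = b ∷ []
  down (suc d) b = (suc d ℕ.+ b) ∷ down d b

  ∈-down⁻ : ∀ d {b x} → x ∈ down d b → b ≤ x × x ≤ d ℕ.+ b
  ∈-down⁻ zero    (here refl) = ≤-refl , ≤-refl
  ∈-down⁻ (suc d) (here refl) = m≤n+m _ (suc d) , ≤-refl
  ∈-down⁻ (suc d) (there m)   = let p , q = ∈-down⁻ d m in p , m≤n⇒m≤1+n q

  ∈-down⁺ : ∀ d {b x} → b ≤ x → x ≤ d ℕ.+ b → x ∈ down d b
  ∈-down⁺ zero    p q = here (≤-antisym q p)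
  ∈-down⁺ (suc d) {b} {x} p q with x ≟ suc d ℕ.+ b
  ... | yes e = here e
  ... | no ¬e = there (∈-down⁺ d p (s≤s⁻¹ (≤∧≢⇒< q ¬e)))

  down-unique : ∀ d b → Unique (down d b)
  down-unique zero    b = [] ∷ []
  down-unique (suc d) b =
    All.tabulate (λ m e → 1+n≰n (subst (_≤ d ℕ.+ b) (sym e) (proj₂ (∈-down⁻ d m)))) ∷ down-unique d b

  -- Removing a horizontal strip amounts to interlacing: the i-th part ranges from α_{i+1} to α_i
  -- independently of the other parts, hence the cartesian product.
  hst : List ℕ → List (List ℕ)
  hst []       = [] ∷ []
  hst (l ∷ ls) = cartesianProductWith _∷_ (down (l ∸ part ls 0) (part ls 0)) (hst ls)

  -- The choices in which the first row loses a cell: that row must be nonempty, and the rest must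
  -- still fit under what is left of it.
  lower : ℕ → List (List ℕ) → List (List ℕ)
  lower zero    qs = []
  lower (suc l) qs = map (l ∷_) (filter (λ q → part q 0 ℕ.≤? l) qs)

  vst : List ℕ → List (List ℕ)
  vst []       = [] ∷ []
  vst (l ∷ ls) = map (l ∷_) (vst ls) ++ lower l (vst ls)

  -- Interlacing already makes γ decreasing; for vertical strips monotonicity has to be demanded
  -- separately.
  HStrip VStrip : List ℕ → List ℕ → Set
  HStrip α γ = length γ ≡ length α × (∀ i → part α (suc i) ≤ part γ i × part γ i ≤ part α i)
  VStrip κ q = length q ≡ length κ × Decr q × (∀ i → part q i ≤ part κ i × part κ i ≤ suc (part q i))

  hst⁻ : ∀ α {γ} → Decr α → γ ∈ hst α → HStrip α γ
  hst⁻ []       d (here refl) = refl , λ i → z≤n , z≤n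
  hst⁻ (l ∷ ls) d m with ∈-cartesianProductWith⁻ _∷_ (down (l ∸ part ls 0) (part ls 0)) (hst ls) m
  ... | x , q , x∈ , q∈ , refl =
    let e , p = hst⁻ ls (decr-tail d) q∈
        u , v = ∈-down⁻ (l ∸ part ls 0) x∈
    in cong suc e , λ { zero    → u , subst (x ≤_) (m∸n+n≡m (d 0)) v
                      ; (suc i) → p i }

  hst⁺ : ∀ α {γ} → Decr α → HStrip α γ → γ ∈ hst α
  hst⁺ []       {[]}    d h       = here refl
  hst⁺ (l ∷ ls) {x ∷ q} d (e , p) = ∈-cartesianProductWith⁺ _∷_
    (∈-down⁺ (l ∸ part ls 0) (proj₁ (p 0)) (subst (x ≤_) (sym (m∸n+n≡m (d 0))) (proj₂ (p 0))))
    (hst⁺ ls (decr-tail d) (suc-injective e , λ i → p (suc i)))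

  hst-unique : ∀ α → Unique (hst α)
  hst-unique []       = [] ∷ []
  hst-unique (l ∷ ls) = Unique.cartesianProductWith⁺ _∷_ (λ { refl → refl , refl })
    (down-unique (l ∸ part ls 0) (part ls 0)) (hst-unique ls)

  ∈-lower⁻ : ∀ l {qs q} → q ∈ lower l qs →
    ∃[ k ] ∃[ q′ ] l ≡ suc k × q ≡ k ∷ q′ × q′ ∈ qs × part q′ 0 ≤ k
  ∈-lower⁻ (suc l) m with ∈-map⁻ (l ∷_) m
  ... | q′ , m′ , refl = let m″ , p = ∈-filter⁻ (λ q → part q 0 ℕ.≤? l) m′ in l , q′ , refl , refl , m″ , p

  vst⁻ : ∀ κ {q} → Decr κ → q ∈ vst κ → VStrip κ q
  vst⁻ []       d (here refl) = refl , (λ i → z≤n) , λ i → z≤n , z≤n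
  vst⁻ (l ∷ ls) d m with ∈-++⁻ (map (l ∷_) (vst ls)) m
  ... | inj₁ m₁ with ∈-map⁻ (l ∷_) m₁
  ...   | q , m₂ , refl =
    let e , dq , p = vst⁻ ls (decr-tail d) m₂
    in cong suc e , decr-∷ (≤-trans (proj₁ (p 0)) (d 0)) dq
     , λ { zero → ≤-refl , n≤1+n l ; (suc i) → p i }
  vst⁻ (l ∷ ls) d m | inj₂ m₁ with ∈-lower⁻ l m₁
  ... | k , q , refl , refl , m₂ , r =
    let e , dq , p = vst⁻ ls (decr-tail d) m₂
    in cong suc e , decr-∷ r dq , λ { zero → n≤1+n k , ≤-refl ; (suc i) → p i }

  vst⁺ : ∀ κ {q} → VStrip κ q → q ∈ vst κ
  vst⁺ []       {[]}    h = here refl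
  vst⁺ (l ∷ ls) {x ∷ q} (e , dq , p)
    with m≤n⇒m<n∨m≡n (proj₁ (p 0)) | vst⁺ ls (suc-injective e , decr-tail dq , λ i → p (suc i))
  ... | inj₂ refl | m = ∈-++⁺ˡ (∈-map⁺ (l ∷_) m)
  ... | inj₁ x<l  | m with ≤-antisym x<l (proj₂ (p 0))
  ...   | refl = ∈-++⁺ʳ (map (l ∷_) (vst ls)) (∈-map⁺ (x ∷_) (∈-filter⁺ (λ q → part q 0 ℕ.≤? x) m (dq 0)))

  lower-unique : ∀ l {qs} → Unique qs → Unique (lower l qs)
  lower-unique zero    u = []
  lower-unique (suc l) u = Unique.map⁺ ∷-injectiveʳ (Unique.filter⁺ (λ q → part q 0 ℕ.≤? l) u)

  vst-unique : ∀ κ → Unique (vst κ)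
  vst-unique []       = [] ∷ []
  vst-unique (l ∷ ls) = Unique.++⁺ (Unique.map⁺ ∷-injectiveʳ (vst-unique ls)) (lower-unique l (vst-unique ls)) disjoint
    where
    disjoint : ∀ {v} → ¬ (v ∈ map (l ∷_) (vst ls) × v ∈ lower l (vst ls))
    disjoint (m , m′) with ∈-map⁻ (l ∷_) m | ∈-lower⁻ l m′
    ... | _ , _ , refl | k , _ , l≡1+k , e , _ = 1+n≢n (sym (trans (sym (∷-injectiveˡ e)) l≡1+k))

  module _ {N M : ℕ} {κ : List ℕ} (d : Decr κ) (len : length κ ≡ N) (b : ∀ i → part κ i ≤ M) where

    private
      α = cj M κ

      α-decr : Decr α
      α-decr = cj-decr {M} {κ} d

      v⇒h : ∀ q → VStrip κ q → HStrip α (cj M q)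
      v⇒h q (e , dq , p) = trans (length-cj M q) (sym (length-cj M κ)) , λ i →
        (≤-ext λ {x} r → let 1+i<M , s = <part-cj⇒ {M} {κ} d r in
           ⇒<part-cj {M} {q} dq (<-trans (n<1+n i) 1+i<M) (s≤s⁻¹ (<-≤-trans s (proj₂ (p x))))) ,
        (≤-ext λ {x} r → let i<M , s = <part-cj⇒ {M} {q} dq r in
           ⇒<part-cj {M} {κ} d i<M (<-≤-trans s (proj₁ (p x))))

      h-decr : ∀ γ → HStrip α γ → Decr γ
      h-decr γ (e , p) i = ≤-trans (proj₂ (p (suc i))) (proj₁ (p i))

      h-cj : ∀ γ → HStrip α γ → cj M (cj N γ) ≡ γ
      h-cj γ h@(e , p) = cj-involutive {M} {N} {γ} (h-decr γ h) (trans e (length-cj M κ))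
        (λ i → ≤-trans (proj₂ (p i)) (subst (part α i ≤_) len (cj-bounded {M} {κ} d i)))

      h⇒v : ∀ γ → HStrip α γ → VStrip κ (cj N γ)
      h⇒v γ h@(e , p) = trans (length-cj N γ) (sym len) , cj-decr {N} {γ} dγ , λ i →
        (≤-ext λ {x} r → let i<N , s = <part-cj⇒ {N} {γ} dγ r in
           proj₂ (<part-cj⇒ {M} {κ} d (<-≤-trans s (proj₂ (p x))))) ,
        (≤-ext λ { {zero} r → s≤s z≤n
                 ; {suc x} r → s≤s (⇒<part-cj {N} {γ} dγ (subst (i <_) len (part-< κ r))
                     (<-≤-trans (⇒<part-cj {M} {κ} d (<-≤-trans r (b i)) r) (proj₁ (p x)))) })
        where dγ = h-decr γ h

      v-cj : ∀ q → VStrip κ q → cj N (cj M q) ≡ q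
      v-cj q (e , dq , p) =
        cj-involutive {N} {M} {q} dq (trans e len) (λ i → ≤-trans (proj₁ (p i)) (b i))

    -- Transposing cells turns "at most one cell per row" into "at most one cell per column". Both
    -- lists are free of duplicates and have the same elements, though perhaps in another order; a
    -- permutation suffices for sums.
    conjugate-strips : map (cj M) (vst κ) ↭ hst (cj M κ)
    conjugate-strips = ∼bag⇒↭ (unique∧set⇒bag unique (hst-unique α) (mk⇔ to from))
      where
      unique : Unique (map (cj M) (vst κ))
      -- `cj N` maps the list back to `vst κ`, and a list with a duplicate-free image has no
      -- duplicates itself.
      unique = Unique.map⁻ {f = cj N} (subst Unique (sym (trans (sym (map-∘ (vst κ)))
        (map-id-local (All.tabulate (λ {q} m → v-cj q (vst⁻ κ d m)))))) (vst-unique κ))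

      to : ∀ {γ} → γ ∈ map (cj M) (vst κ) → γ ∈ hst α
      to m with ∈-map⁻ (cj M) m
      ... | q , q∈ , refl = hst⁺ α α-decr (v⇒h q (vst⁻ κ d q∈))

      from : ∀ {γ} → γ ∈ hst α → γ ∈ map (cj M) (vst κ)
      from {γ} m = let h = hst⁻ α α-decr m in
        subst (_∈ map (cj M) (vst κ)) (h-cj γ h) (∈-map⁺ (cj M) (vst⁺ κ {cj N γ} (h⇒v γ h)))

  -- The partitions contained in a given one

  trim : List ℕ → List ℕ
  trim []           = []
  trim (zero  ∷ ks) = []
  trim (suc k ∷ ks) = suc k ∷ trim ks

  All>0 : List ℕ → Set
  All>0 = All (1 ≤_)

  -- `subPartitions` lists partitions without zeros, while κ may end in some; `trim κ` is the only
  -- candidate for κ there.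
  trim-unique : ∀ {μ} κ → All>0 μ → (∀ i → part μ i ≡ part κ i) → μ ≡ trim κ
  trim-unique {[]}        []           a p = refl
  trim-unique {[]}        (k ∷ ks)     a p with refl ← p 0 = refl
  trim-unique {suc m ∷ μ} []       (_ ∷ a) p with () ← p 0
  trim-unique {suc m ∷ μ} (k ∷ ks) (_ ∷ a) p with refl ← p 0 =
    cong (suc m ∷_) (trim-unique ks a (λ i → p (suc i)))

  trim-++ : ∀ {κ} → Decr κ → ∃[ k ] κ ≡ trim κ ++ replicate k 0
  trim-++ {[]}         d = 0 , refl
  trim-++ {suc k ∷ ks} d = let j , e = trim-++ {ks} (decr-tail d) in j , cong (suc k ∷_) e
  trim-++ {zero ∷ ks}  d = suc (length ks) , cong (0 ∷_) (zeros ks (λ i → n≤0⇒n≡0 (decr-≤head (zero ∷ ks) d (suc i))))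
    where
    zeros : ∀ ks → (∀ i → part ks i ≡ 0) → ks ≡ replicate (length ks) 0
    zeros []       p = refl
    zeros (k ∷ ks) p = cong₂ _∷_ (p 0) (zeros ks (λ i → p (suc i)))

  sub⁺ : ∀ ls b κ → Decr κ → (∀ i → part κ i ≤ part ls i) → part κ 0 ≤ b → trim κ ∈ subsBounded ls b
  sub⁺ []       b []           d p q = here refl
  sub⁺ []       b (zero ∷ ks)  d p q = here refl
  sub⁺ []       b (suc k ∷ ks) d p q with () ← p 0
  sub⁺ (l ∷ ls) b []           d p q = here refl
  sub⁺ (l ∷ ls) b (zero ∷ ks)  d p q = here refl
  sub⁺ (l ∷ ls) b (suc k ∷ ks) d p q = there (∈-concatMap⁺ (λ k → map (suc k ∷_) (subsBounded ls (suc k)))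
    (lose (∈-upTo⁺ (⊓-glb (p 0) q)) (∈-map⁺ (suc k ∷_) (sub⁺ ls (suc k) ks (decr-tail d) (λ i → p (suc i)) (d 0)))))

  sub⁻ : ∀ ls b {μ} → μ ∈ subsBounded ls b →
    Decr μ × All>0 μ × part μ 0 ≤ b × (∀ i → part μ i ≤ part ls i)
  sub⁻ []       b (here refl) = (λ i → z≤n) , [] , z≤n , λ i → z≤n
  sub⁻ (l ∷ ls) b (here refl) = (λ i → z≤n) , [] , z≤n , λ i → z≤n
  sub⁻ (l ∷ ls) b (there m) with find (∈-concatMap⁻ (λ k → map (suc k ∷_) (subsBounded ls (suc k))) {xs = upTo (l ⊓ b)} m)
  ... | k , k∈ , m′ with ∈-map⁻ (suc k ∷_) m′
  ...   | μ , m″ , refl =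
    let d , a , q , p = sub⁻ ls (suc k) m″
        k< = ∈-upTo⁻ k∈
    in decr-∷ q d , s≤s z≤n ∷ a , ≤-trans k< (m⊓n≤n l b) , λ { zero → ≤-trans k< (m⊓n≤m l b) ; (suc i) → p i }

  sub-unique : ∀ ls b → Unique (subsBounded ls b)
  sub-unique []       b = [] ∷ []
  sub-unique (l ∷ ls) b = All.tabulate []∉ ∷ Unique.concat⁺
      (AllP.map⁺ (All.universal (λ k → Unique.map⁺ ∷-injectiveʳ (sub-unique ls (suc k))) (upTo (l ⊓ b))))
      (AllPairsP.map⁺ (AllPairs.map disjoint (Unique.upTo⁺ (l ⊓ b))))
    where
    ext : ℕ → List (List ℕ)
    ext k = map (suc k ∷_) (subsBounded ls (suc k))

    []∉ : ∀ {μ} → μ ∈ concatMap ext (upTo (l ⊓ b)) → [] ≢ μ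
    []∉ m refl with find (∈-concatMap⁻ ext {xs = upTo (l ⊓ b)} m)
    ... | k , _ , m′ with ∈-map⁻ (suc k ∷_) m′
    ...   | _ , _ , ()

    disjoint : ∀ {i j} → i ≢ j → ∀ {v} → ¬ (v ∈ ext i × v ∈ ext j)
    disjoint {i} {j} i≢j (m , m′) with ∈-map⁻ (suc i ∷_) m | ∈-map⁻ (suc j ∷_) m′
    ... | _ , _ , refl | _ , _ , e = i≢j (suc-injective (∷-injectiveˡ e))

open Partitions

-- Jacobi–Trudi minors

β : List ℕ → List ℕ
β []       = []
β (l ∷ ls) = (l ℕ.+ length ls) ∷ β ls

-- The numbers λ_i + N - i, raised by one to match the offset between rows and columns in `fam`: the
-- i-th row of `pos λ` and the j-th column of `β μ` meet in the coefficient of index λ_i - μ_j - i +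
-- j.
pos : List ℕ → List ℕ
pos []       = []
pos (l ∷ ls) = suc (l ℕ.+ length ls) ∷ pos ls

pos-β : ∀ L → pos L ≡ map suc (β L)
pos-β []       = ≡.refl
pos-β (l ∷ ls) = ≡.cong (suc (l ℕ.+ length ls) ∷_) (pos-β ls)

zeros : ℕ → List ℕ
zeros n = replicate n 0

β-bounded : ∀ ls {b} → part ls 0 ≤ b → Decr ls → All (_< b ℕ.+ length ls) (β ls)
β-bounded []       p d = []
β-bounded (l ∷ ls) {b} p d = q ∷ All.map (λ r → ℕ.<-trans r q) (β-bounded ls (d 0) (decr-tail d))
  where
  q : l ℕ.+ length ls < b ℕ.+ suc (length ls)
  q = ℕ.+-mono-≤-< p (ℕ.n<1+n (length ls))

β-below : ∀ {l k} (ls ks : List ℕ) → length ls ≡ length ks → Decr (l ∷ ls) → l < k →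
  All (_< k ℕ.+ length ks) (β (l ∷ ls))
β-below {l} {k} ls ks e d l<k = All.map (λ p → ℕ.<-≤-trans p bound) (β-bounded (l ∷ ls) (ℕ.≤-refl {l}) d)
  where
  bound : l ℕ.+ suc (length ls) ≤ k ℕ.+ length ks
  bound = ℕ.≤-trans
    (ℕ.≤-reflexive (≡.trans (ℕ.+-suc l (length ls)) (≡.cong (suc l ℕ.+_) e)))
    (ℕ.+-monoˡ-≤ (length ks) l<k)

β-snoc : ∀ ls → β (ls ++ 0 ∷ []) ≡ map suc (β ls) ++ 0 ∷ []
β-snoc []       = ≡.refl
β-snoc (l ∷ ls) = ≡.cong₂ _∷_
  (≡.trans (≡.cong (l ℕ.+_) (≡.trans (length-++ ls) (ℕ.+-comm (length ls) 1))) (ℕ.+-suc l (length ls)))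
  (β-snoc ls)

pos-snoc : ∀ ls → pos (ls ++ 0 ∷ []) ≡ map suc (pos ls) ++ 1 ∷ []
pos-snoc []       = ≡.refl
pos-snoc (l ∷ ls) = ≡.cong₂ _∷_
  (≡.cong suc (≡.trans (≡.cong (l ℕ.+_) (≡.trans (length-++ ls) (ℕ.+-comm (length ls) 1))) (ℕ.+-suc l (length ls))))
  (pos-snoc ls)

zeros-snoc : ∀ n → zeros n ++ 0 ∷ [] ≡ zeros (suc n)
zeros-snoc zero    = ≡.refl
zeros-snoc (suc n) = ≡.cong (0 ∷_) (zeros-snoc n)

zeros-++ : ∀ n k → zeros n ++ zeros k ≡ zeros (n ℕ.+ k)
zeros-++ zero    k = ≡.refl
zeros-++ (suc n) k = ≡.cong (0 ∷_) (zeros-++ n k)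

part-zeros : ∀ n i → part (zeros n) i ≡ 0
part-zeros zero    i       = ≡.refl
part-zeros (suc n) zero    = ≡.refl
part-zeros (suc n) (suc i) = part-zeros n i

module JacobiTrudi (R : CRing) where
  open CommutativeRing R
  open RingProperties (CommutativeRing.ring R)
    using (-‿distribˡ-*; -0#≈0#)
  open PowerSeries R
  open Generating R
  open Sums R
  open Minors R
  open SetoidReasoning setoid

  sh : Series → ℕ → ℕ → Carrier
  sh a p       zero    = a p
  sh a zero    (suc q) = 0#
  sh a (suc p) (suc q) = sh a p q

  -- Row p of the Toeplitz matrix of a.  Rows are shifted by one against
  -- columns, so that row 0 vanishes and serves as a sentinel below the minor.
  fam : Series → ℕ → ℕ → Carrier
  fam a p c = sh a p (suc c)

  sh-cong : ∀ {a b} → a ≋ b → ∀ p q → sh a p q ≈ sh b p q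
  sh-cong e p       zero    = e p
  sh-cong e zero    (suc q) = refl
  sh-cong e (suc p) (suc q) = sh-cong e p q

  fam-cong : ∀ {a b} → a ≋ b → ∀ p c → fam a p c ≈ fam b p c
  fam-cong e p c = sh-cong e p (suc c)

  D-fam-cong : ∀ {a b} → a ≋ b → ∀ ps cs → D (fam a) ps cs ≈ D (fam b) ps cs
  D-fam-cong e = D-cong (fam-cong e)

  sh-lin : ∀ y g p q → sh (lin y ⊛ g) p q ≈ sh g p q + y * sh g p (suc q)
  sh-lin y g zero    zero    =
    trans (lin⊛-zero y g) (sym (trans (+-congˡ (zeroʳ y)) (+-identityʳ _)))
  sh-lin y g (suc p) zero    = lin⊛-suc y g p
  sh-lin y g zero    (suc q) = sym (trans (+-congˡ (zeroʳ y)) (+-identityʳ _))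
  sh-lin y g (suc p) (suc q) = sh-lin y g p q

  fam-lin : ∀ y g p c → fam (lin y ⊛ g) (suc p) c ≈ fam g (suc p) c + y * fam g p c
  fam-lin y g p c = sh-lin y g p c

  lin⊛pow⊛ : ∀ y g → lin (- y) ⊛ (pow y ⊛ g) ≋ g
  lin⊛pow⊛ y g = S.trans (S.sym (⊛-assoc (lin (- y)) (pow y) g))
    (S.trans (⊛-cong (lin-pow y) S.refl) (⊛-identityˡ g))

  cancel-neg : ∀ {x y z w} → x ≈ z + - y * w → z ≈ x + y * w
  cancel-neg {x} {y} {z} {w} e = sym (begin
    x + y * w                  ≈⟨ +-congʳ e ⟩
    (z + - y * w) + y * w      ≈⟨ +-assoc _ _ _ ⟩
    z + (- y * w + y * w)      ≈⟨ +-congˡ (+-congʳ (sym (-‿distribˡ-* y w))) ⟩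
    z + (- (y * w) + y * w)    ≈⟨ +-congˡ (-‿inverseˡ _) ⟩
    z + 0#                     ≈⟨ +-identityʳ z ⟩
    z ∎)

  -- The row form of G = g + yzG for G = g/(1 - yz).
  fam-pow : ∀ y g p c → fam (pow y ⊛ g) (suc p) c ≈ fam g (suc p) c + y * fam (pow y ⊛ g) p c
  fam-pow y g p c = cancel-neg (begin
    fam g (suc p) c                      ≈⟨ fam-cong (S.sym (lin⊛pow⊛ y g)) (suc p) c ⟩
    fam (lin (- y) ⊛ G) (suc p) c        ≈⟨ fam-lin (- y) G p c ⟩
    fam G (suc p) c + - y * fam G p c    ∎)
    where G = pow y ⊛ g

  -- Row part q 0 + length q is the first row of pos q, or the sentinel if q is empty.
  repeated-row : ∀ a q cs → E (fam a (part q 0 ℕ.+ length q)) (D (fam a) (pos q)) cs ≈ 0#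
  repeated-row a []      cs = E-0ˡ (D (fam a) []) (λ _ → refl) cs
  repeated-row a (x ∷ q) cs rewrite ℕ.+-suc x (length q) =
    E-alternating (fam a (suc (x ℕ.+ length q))) (D (fam a) (pos q)) cs

  module _ (y : Carrier) (g : Series) where

    private
      vweight : List ℕ → List ℕ → List ℕ → Carrier
      vweight cs κ q = pow y (sum κ ∸ sum q) * D (fam g) (pos q) cs

    -- A term of the multilinear expansion that is not a vertical strip repeats a row.
    D-lin : ∀ κ → Decr κ → ∀ cs → D (fam (lin y ⊛ g)) (pos κ) cs ≈ Sum (vst κ) (vweight cs κ)
    D-lin []       d []       = sym (trans (+-identityʳ _) (*-identityˡ 1#))
    D-lin []       d (c ∷ cs) = sym (trans (+-identityʳ _) (*-identityˡ 0#))
    D-lin (l ∷ ls) d cs = begin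
      E (fam (lin y ⊛ g) (suc r)) (D (fam (lin y ⊛ g)) (pos ls)) cs
        ≈⟨ E-cong (fam-lin y g r) (D-lin ls (decr-tail d)) cs ⟩
      E (λ c → fam g (suc r) c + y * fam g r c) (λ ds → Sum (vst ls) (vweight ds ls)) cs
        ≈⟨ E-Sumʳ (vst ls) w _ (λ q → D (fam g) (pos q)) cs ⟩
      Sum (vst ls) (λ q → w q * E (λ c → fam g (suc r) c + y * fam g r c) (D (fam g) (pos q)) cs)
        ≈⟨ Sum-cong (vst ls) (λ q → trans (*-congˡ (trans (E-+ˡ (fam g (suc r)) (λ c → y * fam g r c) (D (fam g) (pos q)) cs)
             (+-congˡ (E-scaleˡ y (fam g r) (D (fam g) (pos q)) cs)))) (distribˡ _ _ _)) ⟩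
      Sum (vst ls) (λ q → w q * stay q + w q * (y * move q))
        ≈⟨ Sum-+ (vst ls) _ _ ⟩
      Sum (vst ls) (λ q → w q * stay q) + Sum (vst ls) (λ q → w q * (y * move q))
        ≈⟨ +-cong (sym stays) (sym (moves l ≡.refl)) ⟩
      Sum (map (l ∷_) (vst ls)) (vweight cs (l ∷ ls)) + Sum (lower l (vst ls)) (vweight cs (l ∷ ls))
        ≈⟨ sym (Sum-++ (map (l ∷_) (vst ls)) _ _) ⟩
      Sum (vst (l ∷ ls)) (vweight cs (l ∷ ls)) ∎
      where
      r = l ℕ.+ length ls
      w : List ℕ → Carrier
      w q = pow y (sum ls ∸ sum q)
      stay move : List ℕ → Carrier
      stay q = E (fam g (suc r)) (D (fam g) (pos q)) cs
      move q = E (fam g r) (D (fam g) (pos q)) cs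

      stays : Sum (map (l ∷_) (vst ls)) (vweight cs (l ∷ ls)) ≈ Sum (vst ls) (λ q → w q * stay q)
      stays = trans (Sum-map (l ∷_) (vst ls) _) (Sum-cong∈ (vst ls) term)
        where
        term : ∀ {q} → q ∈ vst ls → vweight cs (l ∷ ls) (l ∷ q) ≈ w q * stay q
        term {q} m with vst⁻ ls (decr-tail d) m
        ... | e , _ rewrite e | ℕ.[m+n]∸[m+o]≡n∸o l (sum ls) (sum q) = refl

      no-move : ∀ q → length q ≡ length ls → part q 0 ≡ l → w q * (y * move q) ≈ 0#
      no-move q e f = trans (*-congˡ (trans (*-congˡ zero-move) (zeroʳ y))) (zeroʳ (w q))
        where
        zero-move : move q ≈ 0#
        zero-move = ≡.subst (λ p → E (fam g p) (D (fam g) (pos q)) cs ≈ 0#)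
          (≡.cong₂ ℕ._+_ f e) (repeated-row g q cs)

      moves : ∀ l′ → l′ ≡ l → Sum (lower l′ (vst ls)) (vweight cs (l ∷ ls)) ≈ Sum (vst ls) (λ q → w q * (y * move q))
      -- An empty first row has no cell to lose. Correspondingly q is empty or starts with 0, so the
      -- moved row is the sentinel or the next row of the minor.
      moves zero ≡.refl = sym (Sum-0 (vst ls) λ {q} m → let e , _ , p = vst⁻ ls (decr-tail d) m in
        no-move q e (ℕ.n≤0⇒n≡0 (ℕ.≤-trans (proj₁ (p 0)) (d 0))))
      moves (suc k) ≡.refl = begin
        Sum (map (k ∷_) (filter (λ q → part q 0 ℕ.≤? k) (vst ls))) (vweight cs (suc k ∷ ls))
          ≈⟨ Sum-map (k ∷_) (filter (λ q → part q 0 ℕ.≤? k) (vst ls)) _ ⟩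
        Sum (filter (λ q → part q 0 ℕ.≤? k) (vst ls)) (λ q → vweight cs (suc k ∷ ls) (k ∷ q))
          -- The terms dropped by `filter` have first part suc k, so the first row, moved down,
          -- collides with the next one.
          ≈⟨ Sum-filter (λ q → part q 0 ℕ.≤? k) (vst ls) (λ {q} m ¬p → let e , _ , p = vst⁻ ls (decr-tail d) m in
               trans (term m) (no-move q e (ℕ.≤-antisym (ℕ.≤-trans (proj₁ (p 0)) (d 0)) (ℕ.≰⇒> ¬p)))) ⟩
        Sum (vst ls) (λ q → vweight cs (suc k ∷ ls) (k ∷ q))
          ≈⟨ Sum-cong∈ (vst ls) term ⟩
        Sum (vst ls) (λ q → w q * (y * move q)) ∎
        where
        term : ∀ {q} → q ∈ vst ls → vweight cs (suc k ∷ ls) (k ∷ q) ≈ w q * (y * move q)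
        term {q} m with vst⁻ ls (decr-tail d) m
        ... | e , _ , p rewrite e
            | ℕ.+-∸-assoc 1 (ℕ.+-monoʳ-≤ k (sum-mono q ls e (λ i → proj₁ (p i))))
            | ℕ.[m+n]∸[m+o]≡n∸o k (sum ls) (sum q) =
          trans (*-congʳ (*-comm y (w q))) (*-assoc _ _ _)

    private
      G = pow y ⊛ g

    -- `fam-pow` is unrolled down to row b + n. If b is the next part and n the number of remaining
    -- rows, this is the next row of the minor (or the sentinel), so the remainder contributes
    -- nothing to it.
    fam-pow-down : ∀ d b n c → fam G (suc (d ℕ.+ b ℕ.+ n)) c ≈
      Sum (down d b) (λ x → pow y (d ℕ.+ b ∸ x) * fam g (suc (x ℕ.+ n)) c) + pow y (suc d) * fam G (b ℕ.+ n) c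
    fam-pow-down zero    b n c rewrite ℕ.n∸n≡0 b = trans (fam-pow y g (b ℕ.+ n) c)
      (+-cong (sym (trans (+-identityʳ _) (*-identityˡ _))) (*-congʳ (sym (*-identityʳ y))))
    fam-pow-down (suc d) b n c = begin
      fam G (suc (suc (d ℕ.+ b ℕ.+ n))) c
        ≈⟨ fam-pow y g (suc (d ℕ.+ b ℕ.+ n)) c ⟩
      t + y * fam G (suc (d ℕ.+ b ℕ.+ n)) c
        ≈⟨ +-congˡ (trans (*-congˡ (fam-pow-down d b n c)) (distribˡ _ _ _)) ⟩
      t + (y * Sum (down d b) (λ x → pow y (d ℕ.+ b ∸ x) * row x) + y * (pow y (suc d) * fam G (b ℕ.+ n) c))
        ≈⟨ +-congˡ (+-cong (trans (sym (Sum-scale (down d b) y _)) (Sum-cong∈ (down d b) shift)) (sym (*-assoc _ _ _))) ⟩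
      t + (Sum (down d b) (λ x → pow y (suc d ℕ.+ b ∸ x) * row x) + pow y (suc (suc d)) * fam G (b ℕ.+ n) c)
        ≈⟨ sym (+-assoc _ _ _) ⟩
      (t + Sum (down d b) (λ x → pow y (suc d ℕ.+ b ∸ x) * row x)) + pow y (suc (suc d)) * fam G (b ℕ.+ n) c
        ≈⟨ +-congʳ (+-congʳ (sym (trans (*-congʳ (reflexive (≡.cong (pow y) (ℕ.n∸n≡0 (d ℕ.+ b))))) (*-identityˡ t)))) ⟩
      Sum (down (suc d) b) (λ x → pow y (suc d ℕ.+ b ∸ x) * row x) + pow y (suc (suc d)) * fam G (b ℕ.+ n) c ∎
      where
      row : ℕ → Carrier
      row x = fam g (suc (x ℕ.+ n)) c
      t = row (suc d ℕ.+ b)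
      shift : ∀ {x} → x ∈ down d b → y * (pow y (d ℕ.+ b ∸ x) * row x) ≈ pow y (suc d ℕ.+ b ∸ x) * row x
      shift {x} m rewrite ℕ.+-∸-assoc 1 (proj₂ (∈-down⁻ d m)) = sym (*-assoc _ _ _)

    -- Kept apart from the full expansion `D-pow`: with the lower rows still those of `G`, this form
    -- also yields the degree count in `D-top`.
    D-pow-row : ∀ l ls → part ls 0 ≤ l → ∀ cs →
      D (fam G) (pos (l ∷ ls)) cs ≈
      E (λ c → Sum (down (l ∸ part ls 0) (part ls 0)) (λ x → pow y (l ∸ x) * fam g (suc (x ℕ.+ length ls)) c))
        (D (fam G) (pos ls)) cs
    D-pow-row l ls p cs = begin
      E (fam G (suc (l ℕ.+ n))) F cs
        ≈⟨ E-cong row≈ (λ _ → refl) cs ⟩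
      E (λ c → row c + pow y (suc δ) * fam G (b ℕ.+ n) c) F cs
        ≈⟨ E-+ˡ row _ F cs ⟩
      E row F cs + E (λ c → pow y (suc δ) * fam G (b ℕ.+ n) c) F cs
        ≈⟨ +-congˡ (trans (E-scaleˡ _ (fam G (b ℕ.+ n)) F cs) (trans (*-congˡ (repeated-row G ls cs)) (zeroʳ _))) ⟩
      E row F cs + 0#
        ≈⟨ +-identityʳ _ ⟩
      E row F cs ∎
      where
      n = length ls
      b = part ls 0
      δ = l ∸ b
      F = D (fam G) (pos ls)
      row : ℕ → Carrier
      row c = Sum (down δ b) (λ x → pow y (l ∸ x) * fam g (suc (x ℕ.+ n)) c)
      row≈ : ∀ c → fam G (suc (l ℕ.+ n)) c ≈ row c + pow y (suc δ) * fam G (b ℕ.+ n) c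
      row≈ c = ≡.subst
        (λ l′ → fam G (suc (l′ ℕ.+ n)) c
          ≈ Sum (down δ b) (λ x → pow y (l′ ∸ x) * fam g (suc (x ℕ.+ n)) c) + pow y (suc δ) * fam G (b ℕ.+ n) c)
        (ℕ.m∸n+n≡m p) (fam-pow-down δ b n c)

    D-pow : ∀ α → Decr α → ∀ cs →
      D (fam G) (pos α) cs ≈ Sum (hst α) (λ γ → pow y (sum α ∸ sum γ) * D (fam g) (pos γ) cs)
    D-pow []       d []       = sym (trans (+-identityʳ _) (*-identityˡ 1#))
    D-pow []       d (c ∷ cs) = sym (trans (+-identityʳ _) (*-identityˡ 0#))
    D-pow (l ∷ ls) d cs = begin
      D (fam G) (pos (l ∷ ls)) cs
        ≈⟨ D-pow-row l ls (d 0) cs ⟩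
      E (λ c → Sum xs (λ x → pow y (l ∸ x) * row x c)) (D (fam G) (pos ls)) cs
        ≈⟨ E-Sumˡ xs (λ x → pow y (l ∸ x)) row (D (fam G) (pos ls)) cs ⟩
      Sum xs (λ x → pow y (l ∸ x) * E (row x) (D (fam G) (pos ls)) cs)
        ≈⟨ Sum-cong∈ xs (λ {x} m → trans (*-congˡ (trans (E-cong (λ _ → refl) (D-pow ls (decr-tail d)) cs)
             (E-Sumʳ (hst ls) w (row x) (λ q → D (fam g) (pos q)) cs)))
             (trans (sym (Sum-scale (hst ls) _ _)) (Sum-cong∈ (hst ls) (term m)))) ⟩
      Sum xs (λ x → Sum (hst ls) (λ q → pow y (sum (l ∷ ls) ∸ sum (x ∷ q)) * D (fam g) (pos (x ∷ q)) cs))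
        ≈⟨ sym (Sum-cartesian _∷_ xs (hst ls) _) ⟩
      Sum (hst (l ∷ ls)) (λ γ → pow y (sum (l ∷ ls) ∸ sum γ) * D (fam g) (pos γ) cs) ∎
      where
      xs = down (l ∸ part ls 0) (part ls 0)
      row : ℕ → ℕ → Carrier
      row x c = fam g (suc (x ℕ.+ length ls)) c
      w : List ℕ → Carrier
      w q = pow y (sum ls ∸ sum q)

      pow-+ : ∀ i j → pow y i * pow y j ≈ pow y (i ℕ.+ j)
      pow-+ zero    j = *-identityˡ _
      pow-+ (suc i) j = trans (*-assoc _ _ _) (*-congˡ (pow-+ i j))

      ∸-+-∸ : ∀ {a b c e} → b ≤ a → e ≤ c → (a ∸ b) ℕ.+ (c ∸ e) ≡ (a ℕ.+ c) ∸ (b ℕ.+ e)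
      ∸-+-∸ {a} {b} {c} {e} p q = ≡.trans (≡.sym (ℕ.+-∸-assoc (a ∸ b) q))
        (≡.trans (≡.cong (_∸ e) (≡.sym (ℕ.+-∸-comm c p))) (ℕ.∸-+-assoc (a ℕ.+ c) b e))

      term : ∀ {x} → x ∈ xs → ∀ {q} → q ∈ hst ls →
        pow y (l ∸ x) * (w q * E (row x) (D (fam g) (pos q)) cs) ≈
        pow y (sum (l ∷ ls) ∸ sum (x ∷ q)) * D (fam g) (pos (x ∷ q)) cs
      term {x} x∈ {q} q∈ with hst⁻ ls (decr-tail d) q∈
      ... | e , p rewrite e = trans (sym (*-assoc _ _ _)) (*-congʳ (trans (pow-+ (l ∸ x) _)
        (reflexive (≡.cong (pow y) (∸-+-∸ (≡.subst (x ≤_) (ℕ.m∸n+n≡m (d 0)) (proj₂ (∈-down⁻ (l ∸ part ls 0) x∈)))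
          (sum-mono q ls e (λ i → proj₂ (p i))))))))

  sh-1-diag : ∀ b → sh S.1# b b ≈ 1#
  sh-1-diag zero    = refl
  sh-1-diag (suc b) = sh-1-diag b

  sh-1-off : ∀ {b c} → b ≢ c → sh S.1# b c ≈ 0#
  sh-1-off {zero}  {zero}  p = contradiction ≡.refl p
  sh-1-off {suc b} {zero}  p = refl
  sh-1-off {zero}  {suc c} p = refl
  sh-1-off {suc b} {suc c} p = sh-1-off (λ e → p (≡.cong suc e))

  D-1-∷ : ∀ l ls ks → length ls ≡ length ks → Decr (l ∷ ks) →
    D (fam S.1#) (pos (l ∷ ls)) (β (l ∷ ks)) ≈ D (fam S.1#) (pos ls) (β ks)
  D-1-∷ l ls ks e d rewrite e = trans (+-cong
      (trans (*-congʳ (sh-1-diag (l ℕ.+ length ks))) (*-identityˡ _))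
      (trans (-‿cong (E-0row (fam S.1# (suc (l ℕ.+ length ks))) _
         (All.map (λ c<b → sh-1-off (λ e → ℕ.<⇒≢ c<b (≡.sym e))) (β-bounded ks (d 0) (decr-tail d)))))
         -0#≈0#))
    (+-identityʳ _)

  D-1-diag : ∀ α → Decr α → D (fam S.1#) (pos α) (β α) ≈ 1#
  D-1-diag []       d = refl
  D-1-diag (l ∷ ls) d = trans (D-1-∷ l ls ls ≡.refl d) (D-1-diag ls (decr-tail d))

  -- Compare the first parts. If they agree, the first row is a unit vector and the minor shrinks.
  -- Otherwise the larger of the two indices exceeds all indices of the other kind, which gives a
  -- zero column or a zero row.
  D-1-off : ∀ α γ → length α ≡ length γ → Decr α → Decr γ → α ≢ γ →
    D (fam S.1#) (pos α) (β γ) ≈ 0#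
  D-1-off []       []       e dα dγ n = contradiction ≡.refl n
  D-1-off (l ∷ ls) (k ∷ ks) e dα dγ n with ℕ.<-cmp l k
  ... | tri≈ _ ≡.refl _ = trans (D-1-∷ l ls ks (ℕ.suc-injective e) dγ)
          (D-1-off ls ks (ℕ.suc-injective e) (decr-tail dα) (decr-tail dγ) (λ e → n (≡.cong (l ∷_) e)))
  ... | tri< l<k _ _ = D-0col (fam S.1#) (k ℕ.+ length ks)
          (≡.subst (All _) (≡.sym (pos-β (l ∷ ls)))
            (AllP.map⁺ (All.map (λ b< → sh-1-off (ℕ.<⇒≢ b<)) (β-below {l} {k} ls ks (ℕ.suc-injective e) dα l<k))))
          (β ks)
  ... | tri> _ _ k<l = E-0row (fam S.1# (suc (l ℕ.+ length ls))) (D (fam S.1#) (pos ls))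
          (All.map (λ c< → sh-1-off (λ e → ℕ.<⇒≢ c< (≡.sym e)))
            (β-below {k} {l} ks ls (≡.sym (ℕ.suc-injective e)) dγ k<l))

  -- A zero part appended to both partitions of a skew shape

  E-snoc : ∀ (r : ℕ → Carrier) F F₀ → (∀ cs → F (map suc cs) ≈ 0#) →
    (∀ cs → F (map suc cs ++ 0 ∷ []) ≈ F₀ cs) →
    ∀ cs → E r F (map suc cs ++ 0 ∷ []) ≈ E (λ c → r (suc c)) F₀ cs
  E-snoc r F F₀ p q []       = trans (+-cong (trans (*-congˡ (p [])) (zeroʳ _)) -0#≈0#) (+-identityˡ 0#)
  E-snoc r F F₀ p q (c ∷ cs) = +-cong (*-congˡ (q cs))
    (-‿cong (E-snoc r (λ ds → F (suc c ∷ ds)) (λ ds → F₀ (c ∷ ds)) (λ ds → p (c ∷ ds)) (λ ds → q (c ∷ ds)) cs))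

  module _ (a : Series) (a-0 : a 0 ≈ 1#) where

    -- The appended row is row 1. Its only nonzero entry is `a 0`, and this stands in the appended
    -- column 0.
    D-snoc : ∀ ps cs → D (fam a) (map suc ps ++ 1 ∷ []) (map suc cs ++ 0 ∷ []) ≈ D (fam a) ps cs
    D-snoc []       []       = trans (+-cong (trans (*-identityʳ _) a-0) -0#≈0#) (+-identityʳ _)
    D-snoc []       (c ∷ cs) = trans (+-cong (zeroˡ _)
      (-‿cong (E-0On (fam a 1) (λ _ → 0#) (λ _ → refl) (All.universal {P = λ _ → ⊤} (λ _ → tt) (map suc cs ++ 0 ∷ [])))))
      (trans (+-identityˡ _) -0#≈0#)
    D-snoc (p ∷ ps) cs       = E-snoc (fam a (suc p)) (D (fam a) (map suc ps ++ 1 ∷ [])) (D (fam a) ps)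
      (λ ds → D-0row (fam a) 1 (map suc ps) (AllP.map⁺ (All.universal (λ _ → refl) ds)))
      (D-snoc ps) cs

    D-pad1 : ∀ α γ → D (fam a) (pos (α ++ 0 ∷ [])) (β (γ ++ 0 ∷ [])) ≈ D (fam a) (pos α) (β γ)
    D-pad1 α γ rewrite pos-snoc α | β-snoc γ = D-snoc (pos α) (β γ)

    D-pad : ∀ k α γ → D (fam a) (pos (α ++ zeros k)) (β (γ ++ zeros k)) ≈ D (fam a) (pos α) (β γ)
    D-pad zero    α γ = reflexive (≡.cong₂ (λ x y → D (fam a) (pos x) (β y)) (++-identityʳ α) (++-identityʳ γ))
    D-pad (suc k) α γ = trans
      (reflexive (≡.cong₂ (λ x y → D (fam a) (pos x) (β y))
        (≡.sym (++-assoc α (0 ∷ []) (zeros k))) (≡.sym (++-assoc γ (0 ∷ []) (zeros k)))))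
      (trans (D-pad k (α ++ 0 ∷ []) (γ ++ 0 ∷ [])) (D-pad1 α γ))

  schurD : Series → List ℕ → Carrier
  schurD a μ = D (fam a) (pos μ) (β (zeros (length μ)))

  schurD-pad : ∀ a → a 0 ≈ 1# → ∀ k μ → schurD a (μ ++ zeros k) ≈ schurD a μ
  schurD-pad a a-0 k μ = trans
    (reflexive (≡.cong (λ z → D (fam a) (pos (μ ++ zeros k)) (β z))
      (≡.trans (≡.cong zeros (≡.trans (length-++ μ) (≡.cong (length μ ℕ.+_) (length-replicate k))))
        (≡.sym (zeros-++ (length μ) k)))))
    (D-pad a a-0 k μ (zeros (length μ)))

  schurD-cong : ∀ {a b} → a ≋ b → ∀ μ → schurD a μ ≈ schurD b μ
  schurD-cong e μ = D-fam-cong e (pos μ) (β (zeros (length μ)))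

  -- The hook Schur polynomial as a single Jacobi–Trudi minor

  module Hook (a : Series) (a-0 : a 0 ≈ 1#) (L : List ℕ) where

    private
      M = part L 0
      S₀ = subPartitions L

    -- The index set and the box stay those of `L` while κ shrinks in the induction, so this sum can
    -- be interchanged with the sum over strips of κ.
    hook-sum : List Carrier → List ℕ → Carrier
    hook-sum ys κ = Sum S₀ (λ μ → schurD a μ * D (fam (hs ys)) (pos (cj M κ)) (β (cj M μ)))

    module _ (dL : Decr L) where

      -- Without y's the skew minor is a Kronecker delta, so only the term of κ itself survives.
      hook-base : ∀ κ → Decr κ → (∀ i → part κ i ≤ part L i) → hook-sum [] κ ≈ schurD a κ
      hook-base κ d p = begin
        hook-sum [] κ
          ≈⟨ Sum-single {xs = S₀} {x = trim κ} _ (sub-unique L M) (sub⁺ L M κ d p (p 0)) off ⟩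
        schurD a (trim κ) * D (fam S.1#) (pos (cj M κ)) (β (cj M (trim κ)))
          ≈⟨ *-cong (sym (schurD-pad a a-0 k (trim κ)))
               (trans (reflexive (≡.cong (λ z → D (fam S.1#) (pos z) (β (cj M (trim κ)))) cj-trim))
                      (D-1-diag (cj M (trim κ)) (cj-decr {M} {trim κ} trim-decr))) ⟩
        schurD a (trim κ ++ zeros k) * 1#
          ≈⟨ trans (*-identityʳ _) (reflexive (≡.cong (schurD a) (≡.sym κ≡))) ⟩
        schurD a κ ∎
        where
        k = proj₁ (trim-++ {κ} d)
        κ≡ = proj₂ (trim-++ {κ} d)

        b : ∀ i → part κ i ≤ M
        b i = ℕ.≤-trans (p i) (decr-≤head L dL i)

        trim-decr : Decr (trim κ)
        trim-decr = proj₁ (sub⁻ L M (sub⁺ L M κ d p (p 0)))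

        part-trim : ∀ i → part κ i ≡ part (trim κ) i
        part-trim i = ≡.trans (≡.cong (λ z → part z i) κ≡) (go (trim κ) i)
          where
          go : ∀ μ i → part (μ ++ zeros k) i ≡ part μ i
          go []      i       = part-zeros k i
          go (m ∷ μ) zero    = ≡.refl
          go (m ∷ μ) (suc i) = go μ i

        cj-trim : cj M κ ≡ cj M (trim κ)
        cj-trim = part-ext _ _ (≡.trans (length-cj M κ) (≡.sym (length-cj M (trim κ)))) λ j → ℕ.≤-antisym
          (≤-ext λ {x} q → let j<M , r = <part-cj⇒ {M} {κ} d q in
            ⇒<part-cj {M} {trim κ} trim-decr j<M (≡.subst (j <_) (part-trim x) r))
          (≤-ext λ {x} q → let j<M , r = <part-cj⇒ {M} {trim κ} trim-decr q in
            ⇒<part-cj {M} {κ} d j<M (≡.subst (j <_) (≡.sym (part-trim x)) r))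

        off : ∀ {μ} → μ ∈ S₀ → μ ≢ trim κ → schurD a μ * D (fam S.1#) (pos (cj M κ)) (β (cj M μ)) ≈ 0#
        off {μ} m n with sub⁻ L M m
        ... | dμ , pμ , _ , qμ = trans (*-congˡ (D-1-off (cj M κ) (cj M μ)
            (≡.trans (length-cj M κ) (≡.sym (length-cj M μ))) (cj-decr {M} {κ} d) (cj-decr {M} {μ} dμ)
            (λ e → n (trim-unique κ pμ (cj-injective {M} {μ} {κ} dμ d
              (λ i → ℕ.≤-trans (qμ i) (decr-≤head L dL i)) b (≡.sym e))))))
          (zeroʳ _)

      -- κ is a variable because the induction hypothesis is applied to κ minus every vertical
      -- strip. One y leaves the conjugate side as a horizontal strip and returns as a factor 1 + yz
      -- on the rows of κ.
      hook : ∀ ys κ → Decr κ → length κ ≡ length L → (∀ i → part κ i ≤ part L i) →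
        hook-sum ys κ ≈ schurD (lins ys ⊛ a) κ
      hook []       κ d e p = trans (hook-base κ d p) (schurD-cong (S.sym (⊛-identityˡ a)) κ)
      hook (y ∷ ys) κ d e p = begin
        Sum S₀ (λ μ → schurD a μ * D (fam (pow y ⊛ hs ys)) (pos α) (β (cj M μ)))
          ≈⟨ Sum-cong S₀ (λ μ → trans (*-congˡ (branch μ)) (sym (Sum-scale (vst κ) _ _))) ⟩
        Sum S₀ (λ μ → Sum (vst κ) (λ q → schurD a μ * (w q * inner μ q)))
          ≈⟨ Sum-swap S₀ (vst κ) _ ⟩
        Sum (vst κ) (λ q → Sum S₀ (λ μ → schurD a μ * (w q * inner μ q)))
          ≈⟨ Sum-cong∈ (vst κ) (λ {q} m → trans (Sum-cong S₀ (λ μ → x∙yz≈y∙xz *-commutativeSemigroup _ _ _))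
               (trans (Sum-scale S₀ (w q) _) (*-congˡ (step m)))) ⟩
        Sum (vst κ) (λ q → w q * D (fam (lins ys ⊛ a)) (pos q) cols)
          ≈⟨ sym (D-lin y (lins ys ⊛ a) κ d cols) ⟩
        schurD (lin y ⊛ (lins ys ⊛ a)) κ
          ≈⟨ schurD-cong (S.sym (⊛-assoc (lin y) (lins ys) a)) κ ⟩
        schurD (lins (y ∷ ys) ⊛ a) κ ∎
        where
        α = cj M κ
        cols = β (zeros (length κ))
        w : List ℕ → Carrier
        w q = pow y (sum κ ∸ sum q)
        inner : List ℕ → List ℕ → Carrier
        inner μ q = D (fam (hs ys)) (pos (cj M q)) (β (cj M μ))

        b : ∀ i → part κ i ≤ M
        b i = ℕ.≤-trans (p i) (decr-≤head L dL i)

        branch : ∀ μ → D (fam (pow y ⊛ hs ys)) (pos α) (β (cj M μ)) ≈ Sum (vst κ) (λ q → w q * inner μ q)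
        branch μ = begin
          D (fam (pow y ⊛ hs ys)) (pos α) (β (cj M μ))
            ≈⟨ D-pow y (hs ys) α (cj-decr {M} {κ} d) (β (cj M μ)) ⟩
          Sum (hst α) f
            ≈⟨ sym (Sum-↭ f (conjugate-strips {M = M} {κ = κ} d e b)) ⟩
          Sum (map (cj M) (vst κ)) f
            ≈⟨ Sum-map (cj M) (vst κ) f ⟩
          Sum (vst κ) (λ q → f (cj M q))
            ≈⟨ Sum-cong∈ (vst κ) (λ {q} m → *-congʳ (reflexive (≡.cong (pow y)
                 (≡.cong₂ _∸_ (sum-cj M κ b)
                   (sum-cj M q (λ i → ℕ.≤-trans (proj₁ (proj₂ (proj₂ (vst⁻ κ d m)) i)) (b i))))))) ⟩
          Sum (vst κ) (λ q → w q * inner μ q) ∎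
          where
          f : List ℕ → Carrier
          f γ = pow y (sum α ∸ sum γ) * D (fam (hs ys)) (pos γ) (β (cj M μ))

        step : ∀ {q} → q ∈ vst κ → hook-sum ys q ≈ D (fam (lins ys ⊛ a)) (pos q) cols
        step {q} m with vst⁻ κ d m
        ... | e′ , dq , pq = trans (hook ys q dq (≡.trans e′ e) (λ i → ℕ.≤-trans (proj₁ (pq i)) (p i)))
          (reflexive (≡.cong (λ n → D (fam (lins ys ⊛ a)) (pos q) (β (zeros n))) e′))

-- Interpreting polynomials in a commutative ring

record PolyHom (k : ℕ) (R : CRing) : Set where
  open CommutativeRing R
  field
    φ   : Poly k → Carrier
    φ-0 : φ 0P ≈ 0#
    φ-1 : φ 1P ≈ 1#
    φ-+ : ∀ p q → φ (p +P q) ≈ φ p + φ q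
    φ-* : ∀ p q → φ (p *P q) ≈ φ p * φ q
    φ-‿ : ∀ p → φ (-P p) ≈ - φ p

tabulate-pos : ∀ N L → length L ≡ N →
  pos L ≡ tabulate {n = N} (λ i → suc (part L (toℕ i) ℕ.+ (N ∸ suc (toℕ i))))
tabulate-pos zero    []       e      = ≡.refl
tabulate-pos (suc N) (l ∷ ls) ≡.refl = ≡.cong (suc (l ℕ.+ N) ∷_) (tabulate-pos N ls ≡.refl)

tabulate-β : ∀ N L → length L ≡ N →
  β L ≡ tabulate {n = N} (λ i → part L (toℕ i) ℕ.+ (N ∸ suc (toℕ i)))
tabulate-β zero    []       e      = ≡.refl
tabulate-β (suc N) (l ∷ ls) ≡.refl = ≡.cong ((l ℕ.+ N) ∷_) (tabulate-β N ls ≡.refl)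

-- u and v stand for N - 1 - i and N - 1 - j. A difference of two naturals is the form in which `sh`
-- can follow by lowering both sides together.
jacobiTrudi-index : ∀ l m i j u v → u ℕ.+ suc i ≡ v ℕ.+ suc j →
  ((+ l ℤ.- + m) ℤ.- + i) ℤ.+ + j ≡ (l ℕ.+ u) ℤ.⊖ (m ℕ.+ v)
jacobiTrudi-index l m i j u v e = begin
  ((+ l ℤ.- + m) ℤ.- + i) ℤ.+ + j
    ≡⟨ regroup (+ l) (+ m) (+ i) (+ j) (+ u) (+ v) ⟩
  ((+ l ℤ.+ + u) ℤ.- (+ m ℤ.+ + v)) ℤ.+ ((+ v ℤ.+ + j) ℤ.- (+ u ℤ.+ + i))
    ≡⟨ ≡.cong (λ z → ((+ l ℤ.+ + u) ℤ.- (+ m ℤ.+ + v)) ℤ.+ z)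
         (≡.trans (≡.cong (ℤ._- (+ u ℤ.+ + i)) (≡.cong +_ (≡.sym e′))) (ℤ.+-inverseʳ (+ (u ℕ.+ i)))) ⟩
  ((+ l ℤ.+ + u) ℤ.- (+ m ℤ.+ + v)) ℤ.+ (+ 0)
    ≡⟨ ℤ.+-identityʳ _ ⟩
  + (l ℕ.+ u) ℤ.- + (m ℕ.+ v)
    ≡⟨ ℤ.m-n≡m⊖n (l ℕ.+ u) (m ℕ.+ v) ⟩
  (l ℕ.+ u) ℤ.⊖ (m ℕ.+ v) ∎
  where
  open ≡.≡-Reasoning
  e′ : u ℕ.+ i ≡ v ℕ.+ j
  e′ = ℕ.suc-injective (≡.trans (≡.sym (ℕ.+-suc u i)) (≡.trans e (ℕ.+-suc v j)))
  regroup : ∀ l m i j u v →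
    ((l ℤ.- m) ℤ.- i) ℤ.+ j ≡ ((l ℤ.+ u) ℤ.- (m ℤ.+ v)) ℤ.+ ((v ℤ.+ j) ℤ.- (u ℤ.+ i))
  regroup = solve-∀

-- `conj μ` stops at μ₁, whereas `cj M μ` has exactly M entries; beyond μ₁ both read as 0.
part-conj : ∀ {μ} M j → Decr μ → j < M → part (conj μ) j ≡ part (cj M μ) j
part-conj {μ} M j d j<M = ≡.trans (go (j ℕ.<? part μ 0)) (≡.sym (part-cj M μ j<M))
  where
  go : _ → part (conj μ) j ≡ cnt j μ
  go (yes p) = part-cj (part μ 0) μ p
  go (no ¬p) = ≡.trans
    (part-beyond (conj μ) (≡.subst (_≤ j) (≡.sym (length-cj (part μ 0) μ)) (ℕ.≮⇒≥ ¬p)))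
    (≡.sym (cnt-small μ (λ i → ℕ.≤-trans (decr-≤head μ d i) (ℕ.≮⇒≥ ¬p))))

module Interpret {k : ℕ} (R : CRing) (hom : PolyHom k R) where
  open CommutativeRing R hiding (zero)
  open RingProperties (CommutativeRing.ring R) using (-0#≈0#; -1*x≈-x)
  open PowerSeries R
  open Generating R
  open Sums R
  open Minors R
  open JacobiTrudi R
  open PolyHom hom
  open SetoidReasoning setoid

  φ-sumP : {A : Set} (f : A → Poly k) (xs : List A) → φ (sumP (map f xs)) ≈ Sum xs (λ x → φ (f x))
  φ-sumP f []       = φ-0
  φ-sumP f (x ∷ xs) = trans (φ-+ _ _) (+-congˡ (φ-sumP f xs))

  φ-powP : ∀ p e → φ (powP p e) ≈ pow (φ p) e
  φ-powP p zero    = φ-1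
  φ-powP p (suc e) = trans (φ-* _ _) (*-congˡ (φ-powP p e))

  ⊛-Sum : ∀ d f g → (f ⊛ g) d ≈ Sum (upTo (suc d)) (λ j → f j * g (d ∸ j))
  ⊛-Sum zero    f g = sym (+-identityʳ _)
  ⊛-Sum (suc d) f g = +-congˡ (begin
    (tl f ⊛ g) d
      ≈⟨ ⊛-Sum d (tl f) g ⟩
    Sum (upTo (suc d)) (λ j → f (suc j) * g (d ∸ j))
      ≈⟨ sym (Sum-map suc (upTo (suc d)) (λ j → f j * g (suc d ∸ j))) ⟩
    Sum (map suc (upTo (suc d))) (λ j → f j * g (suc d ∸ j))
      ≈⟨ reflexive (≡.cong (λ xs → Sum xs (λ j → f j * g (suc d ∸ j))) (map-upTo suc (suc d))) ⟩
    Sum (applyUpTo suc (suc d)) (λ j → f j * g (suc d ∸ j)) ∎)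

  φ-hN : ∀ zs d → φ (hN zs d) ≈ hs (map φ zs) d
  φ-hN []       zero    = φ-1
  φ-hN []       (suc d) = φ-0
  φ-hN (z ∷ zs) d       = begin
    φ (hN (z ∷ zs) d)
      ≈⟨ φ-sumP (λ j → powP z j *P hN zs (d ∸ j)) (upTo (suc d)) ⟩
    Sum (upTo (suc d)) (λ j → φ (powP z j *P hN zs (d ∸ j)))
      ≈⟨ Sum-cong (upTo (suc d)) (λ j → trans (φ-* _ _) (*-cong (φ-powP z j) (φ-hN zs (d ∸ j)))) ⟩
    Sum (upTo (suc d)) (λ j → pow (φ z) j * hs (map φ zs) (d ∸ j))
      ≈⟨ sym (⊛-Sum d (pow (φ z)) (hs (map φ zs))) ⟩
    hs (map φ (z ∷ zs)) d ∎

  φ-h : ∀ zs x y → φ (h zs (x ℤ.⊖ y)) ≈ sh (hs (map φ zs)) x y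
  φ-h zs x       zero    = φ-hN zs x
  φ-h zs zero    (suc y) = φ-0
  φ-h zs (suc x) (suc y) =
    trans (reflexive (≡.cong (φ ∘ h zs) (ℤ.[1+m]⊖[1+n]≡m⊖n x y))) (φ-h zs x y)

  -- `det` carries the signs (-1)^j explicitly, `E` produces them by nested negation. Pulling one
  -- factor -1 out of all columns after the first reconciles the two.
  E-tabulate : ∀ N (r : ℕ → Carrier) F (c : Fin (suc N) → ℕ) →
    Sum (allFin (suc N)) (λ j → (pow (- 1#) (toℕ j) * r (c j)) * F (tabulate (c ∘ punchIn j)))
      ≈ E r F (tabulate c)
  E-tabulate N r F c = +-cong (*-congʳ (*-identityˡ _)) (rest N c)
    where
    rest : ∀ N (c : Fin (suc N) → ℕ) →
      Sum (tabulate {n = N} suc) (λ j → (pow (- 1#) (toℕ j) * r (c j)) * F (tabulate (c ∘ punchIn j)))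
        ≈ - E r (λ ds → F (c zero ∷ ds)) (tabulate (c ∘ suc))
    rest zero    c = sym -0#≈0#
    rest (suc N) c = begin
      Sum (tabulate suc) G
        ≈⟨ reflexive (≡.cong (λ xs → Sum xs G) (≡.sym (map-tabulate id suc))) ⟩
      Sum (map suc (allFin (suc N))) G
        ≈⟨ Sum-map suc (allFin (suc N)) G ⟩
      Sum (allFin (suc N)) (λ j → (- 1# * pow (- 1#) (toℕ j) * r (c (suc j))) * F (c zero ∷ tabulate (c ∘ suc ∘ punchIn j)))
        ≈⟨ Sum-cong (allFin (suc N)) (λ j → trans (*-congʳ (*-assoc _ _ _)) (*-assoc _ _ _)) ⟩
      Sum (allFin (suc N)) (λ j → - 1# * ((pow (- 1#) (toℕ j) * r (c (suc j))) * F (c zero ∷ tabulate (c ∘ suc ∘ punchIn j))))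
        ≈⟨ Sum-scale (allFin (suc N)) (- 1#) _ ⟩
      - 1# * Sum (allFin (suc N)) (λ j → (pow (- 1#) (toℕ j) * r (c (suc j))) * F (c zero ∷ tabulate (c ∘ suc ∘ punchIn j)))
        ≈⟨ -1*x≈-x _ ⟩
      - Sum (allFin (suc N)) (λ j → (pow (- 1#) (toℕ j) * r (c (suc j))) * F (c zero ∷ tabulate (c ∘ suc ∘ punchIn j)))
        ≈⟨ -‿cong (E-tabulate N r (λ ds → F (c zero ∷ ds)) (c ∘ suc)) ⟩
      - E r (λ ds → F (c zero ∷ ds)) (tabulate (c ∘ suc)) ∎
      where
      G : Fin (suc (suc N)) → Carrier
      G j = (pow (- 1#) (toℕ j) * r (c j)) * F (tabulate (c ∘ punchIn j))

  φ-det : ∀ N (M : Fin N → Fin N → Poly k) (a : ℕ → ℕ → Carrier) (p c : Fin N → ℕ) →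
    (∀ i j → φ (M i j) ≈ a (p i) (c j)) → φ (det N M) ≈ D a (tabulate p) (tabulate c)
  φ-det zero    M a p c e = φ-1
  φ-det (suc N) M a p c e = begin
    φ (det (suc N) M)
      ≈⟨ φ-sumP (λ j → powP (-P 1P) (toℕ j) *P M zero j *P det N (λ x y → M (suc x) (punchIn j y))) (allFin (suc N)) ⟩
    Sum (allFin (suc N)) (λ j → φ (powP (-P 1P) (toℕ j) *P M zero j *P det N (λ x y → M (suc x) (punchIn j y))))
      ≈⟨ Sum-cong (allFin (suc N)) (λ j → trans (φ-* _ _) (*-cong
           (trans (φ-* _ _) (*-cong (trans (φ-powP _ (toℕ j)) (pow-cong (toℕ j))) (e zero j)))
           (φ-det N (λ x y → M (suc x) (punchIn j y)) a (p ∘ suc) (c ∘ punchIn j) (λ x y → e (suc x) (punchIn j y))))) ⟩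
    Sum (allFin (suc N)) (λ j → (pow (- 1#) (toℕ j) * a (p zero) (c j)) * D a (tabulate (p ∘ suc)) (tabulate (c ∘ punchIn j)))
      ≈⟨ E-tabulate N (a (p zero)) (D a (tabulate (p ∘ suc))) c ⟩
    D a (tabulate p) (tabulate c) ∎
    where
    pow-cong : ∀ n → pow (φ (-P 1P)) n ≈ pow (- 1#) n
    pow-cong zero    = refl
    pow-cong (suc n) = *-cong (trans (φ-‿ 1P) (-‿cong φ-1)) (pow-cong n)

  -- γ is μ brought to the number of rows of `L`; the determinant reads no further parts.
  φ-skewSchur : ∀ zs L μ γ → length γ ≡ length L → (∀ j → j < length L → part μ j ≡ part γ j) →
    φ (skewSchur zs L μ) ≈ D (fam (hs (map φ zs))) (pos L) (β γ)
  φ-skewSchur zs L μ γ e p = trans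
    (φ-det N _ (fam (hs (map φ zs))) (λ i → suc (part L (toℕ i) ℕ.+ (N ∸ suc (toℕ i))))
      (λ j → part γ (toℕ j) ℕ.+ (N ∸ suc (toℕ j))) entry)
    (reflexive (≡.cong₂ (D (fam (hs (map φ zs)))) (≡.sym (tabulate-pos N L ≡.refl)) (≡.sym (tabulate-β N γ e))))
    where
    N = length L
    entry : ∀ (i j : Fin N) →
      φ (h zs ((+ part L (toℕ i) ℤ.- + part μ (toℕ j)) ℤ.- + toℕ i ℤ.+ + toℕ j))
        ≈ sh (hs (map φ zs)) (part L (toℕ i) ℕ.+ (N ∸ suc (toℕ i))) (part γ (toℕ j) ℕ.+ (N ∸ suc (toℕ j)))
    entry i j rewrite p (toℕ j) (toℕ<n j) = trans
      (reflexive (≡.cong (φ ∘ h zs) (jacobiTrudi-index (part L (toℕ i)) (part γ (toℕ j)) (toℕ i) (toℕ j) _ _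
        (≡.trans (ℕ.m∸n+n≡m (toℕ<n i)) (≡.sym (ℕ.m∸n+n≡m (toℕ<n j)))))))
      (φ-h zs (part L (toℕ i) ℕ.+ (N ∸ suc (toℕ i))) (part γ (toℕ j) ℕ.+ (N ∸ suc (toℕ j))))

  φ-schur : ∀ zs L → φ (schur zs L) ≈ schurD (hs (map φ zs)) L
  φ-schur zs L = φ-skewSchur zs L [] (zeros (length L)) (length-replicate (length L))
    (λ j _ → ≡.sym (part-zeros (length L) j))

  φ-hookSchur : ∀ xs ys L → Decr L →
    φ (hookSchur xs ys L) ≈ schurD (lins (map φ ys) ⊛ hs (map φ xs)) L
  φ-hookSchur xs ys L d = begin
    φ (hookSchur xs ys L)
      ≈⟨ φ-sumP (λ μ → schur xs μ *P skewSchur ys (conj L) (conj μ)) (subPartitions L) ⟩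
    Sum (subPartitions L) (λ μ → φ (schur xs μ *P skewSchur ys (conj L) (conj μ)))
      ≈⟨ Sum-cong∈ (subPartitions L) (λ {μ} m → trans (φ-* _ _) (*-cong (φ-schur xs μ)
           (φ-skewSchur ys (conj L) (conj μ) (cj M μ) (≡.trans (length-cj M μ) (≡.sym (length-cj M L)))
             (λ j j< → part-conj {μ} M j (proj₁ (sub⁻ L M m)) (≡.subst (j <_) (length-cj M L) j<))))) ⟩
    hook-sum (map φ ys) L
      ≈⟨ hook d (map φ ys) L d ≡.refl (λ i → ℕ.≤-refl) ⟩
    schurD (lins (map φ ys) ⊛ hs (map φ xs)) L ∎
    where
    M = part L 0
    open Hook (hs (map φ xs)) (hs-0 (map φ xs)) L

tabulate-↑ : {A : Set} (n : ℕ) {m : ℕ} (f : Fin (n ℕ.+ m) → A) →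
  tabulate f ≡ tabulate (λ i → f (i ↑ˡ m)) ++ tabulate (λ j → f (n ↑ʳ j))
tabulate-↑ zero    f = ≡.refl
tabulate-↑ (suc n) f = ≡.cong (f zero ∷_) (tabulate-↑ n (f ∘ suc))

XYvars-++ : ∀ n m → XYvars n m ≡ Xvars n m ++ Yvars n m
XYvars-++ n m = ≡.trans (map-tabulate id var) (≡.trans (tabulate-↑ n var)
  (≡.sym (≡.cong₂ _++_ (map-tabulate id (λ i → var (i ↑ˡ m))) (map-tabulate id (λ j → var (n ↑ʳ j))))))

-- Poly k as a subring of the iterated power series ring

iterated : ℕ → CRing
iterated zero    = ℤ.+-*-commutativeRing
iterated (suc k) = PowerSeries.seriesRing (iterated k)

module _ where
  open CommutativeRing hiding (zero)

  -- Extending by zeros identifies coefficient lists that differ in trailing zeros only, and the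
  -- target is a ring whose laws are already available.
  ι : ∀ {k} → Poly k → Carrier (iterated k)
  ι {zero}  a               = a
  ι {suc k} []      n       = 0# (iterated k)
  ι {suc k} (a ∷ p) zero    = ι a
  ι {suc k} (a ∷ p) (suc n) = ι p n

  ι-zero : ∀ {k} (p : Poly k) → _≈_ (iterated k) (ι p) (0# (iterated k)) → IsZeroP p
  ι-zero {zero}  a       e = e
  ι-zero {suc k} []      e = tt
  ι-zero {suc k} (a ∷ p) e = ι-zero a (e 0) , ι-zero p (λ n → e (suc n))

  ι-0 : ∀ {k} → _≈_ (iterated k) (ι {k} 0P) (0# (iterated k))
  ι-0 {zero}  = ≡.refl
  ι-0 {suc k} = λ n → refl (iterated k)

  ι-1 : ∀ {k} → _≈_ (iterated k) (ι {k} 1P) (1# (iterated k))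
  ι-1 {zero}          = ≡.refl
  ι-1 {suc k} zero    = ι-1 {k}
  ι-1 {suc k} (suc n) = refl (iterated k)

  ι-+ : ∀ {k} (p q : Poly k) → _≈_ (iterated k) (ι (p +P q)) (_+_ (iterated k) (ι p) (ι q))
  ι-+ {zero}  a       b               = ≡.refl
  ι-+ {suc k} []      q       n       = sym (iterated k) (+-identityˡ (iterated k) _)
  ι-+ {suc k} (a ∷ p) []      n       = sym (iterated k) (+-identityʳ (iterated k) _)
  ι-+ {suc k} (a ∷ p) (b ∷ q) zero    = ι-+ a b
  ι-+ {suc k} (a ∷ p) (b ∷ q) (suc n) = ι-+ p q n

  ι-‿ : ∀ {k} (p : Poly k) → _≈_ (iterated k) (ι (-P p)) (-_ (iterated k) (ι p))
  ι-‿ {zero}  a               = ≡.refl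
  ι-‿ {suc k} []      n       = sym (iterated k) (RingProperties.-0#≈0# (ring (iterated k)))
  ι-‿ {suc k} (a ∷ p) zero    = ι-‿ a
  ι-‿ {suc k} (a ∷ p) (suc n) = ι-‿ p n

  ι-* : ∀ {k} (p q : Poly k) → _≈_ (iterated k) (ι (p *P q)) (_*_ (iterated k) (ι p) (ι q))
  ι-map : ∀ {k} (a : Poly k) (q : Poly (suc k)) n →
    _≈_ (iterated k) (ι (map (a *P_) q) n) (_*_ (iterated k) (ι a) (ι q n))

  ι-* {zero}  a       b       = ≡.refl
  ι-* {suc k} []      q       n = sym R (PowerSeries.⊛-zeroˡ R (λ _ → 0# R) (ι q) (λ _ → refl R) n)
    where R = iterated k
  ι-* {suc k} (a ∷ p) q zero    = trans R (ι-+ (map (a *P_) q) (0P ∷ (p *P q)) 0)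
    (trans R (+-cong R (ι-map a q 0) (ι-0 {k})) (+-identityʳ R _))
    where R = iterated k
  ι-* {suc k} (a ∷ p) q (suc n) = trans R (ι-+ (map (a *P_) q) (0P ∷ (p *P q)) (suc n))
    (+-cong R (ι-map a q (suc n)) (ι-* p q n))
    where R = iterated k

  ι-map {k} a []      n       = sym R (zeroʳ R _)
    where R = iterated k
  ι-map a (b ∷ q) zero    = ι-* a b
  ι-map a (b ∷ q) (suc n) = ι-map a q n

ι-hom : ∀ k → PolyHom k (iterated k)
ι-hom k = record { φ = ι ; φ-0 = ι-0 {k} ; φ-1 = ι-1 {k} ; φ-+ = ι-+ ; φ-* = ι-* ; φ-‿ = ι-‿ }

ι-reflects : ∀ {k} {p q : Poly k} → CommutativeRing._≈_ (iterated k) (ι p) (ι q) → p ≈P q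
ι-reflects {k} {p} {q} e = ι-zero (p +P (-P q))
  (trans (ι-+ p (-P q)) (trans (+-cong e (ι-‿ q)) (-‿inverseʳ (ι q))))
  where open CommutativeRing (iterated k)

-- Evaluation

record ℤ-Algebra : Set₁ where
  field
    R : CRing
  open CommutativeRing R hiding (zero)
  field
    ζ   : ℤ → Carrier
    ζ-0 : ζ (+ 0) ≈ 0#
    ζ-1 : ζ (+ 1) ≈ 1#
    ζ-+ : ∀ a b → ζ (a ℤ.+ b) ≈ ζ a + ζ b
    ζ-* : ∀ a b → ζ (a ℤ.* b) ≈ ζ a * ζ b
    ζ-‿ : ∀ a → ζ (ℤ.- a) ≈ - ζ a

integers : ℤ-Algebra
integers = record
  { R = ℤ.+-*-commutativeRing ; ζ = λ a → a ; ζ-0 = ≡.refl ; ζ-1 = ≡.refl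
  ; ζ-+ = λ _ _ → ≡.refl ; ζ-* = λ _ _ → ≡.refl ; ζ-‿ = λ _ → ≡.refl }

-- The source of fresh indeterminates: a statement about all ℤ-algebras may be applied here and its
-- coefficients read in A.
series : ℤ-Algebra → ℤ-Algebra
series A = record
  { R = seriesRing
  ; ζ = λ a → const (ζ a)
  ; ζ-0 = λ n → trans (const-cong ζ-0 n) (const-0 n)
  ; ζ-1 = const-cong ζ-1
  ; ζ-+ = λ a b n → trans (const-cong (ζ-+ a b) n) (const-+ (ζ a) (ζ b) n)
  ; ζ-* = λ a b n → trans (const-cong (ζ-* a b) n) (const-* (ζ a) (ζ b) n)
  ; ζ-‿ = λ a n → trans (const-cong (ζ-‿ a) n) (const-neg (ζ a) n)
  }
  where
  open ℤ-Algebra A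
  open CommutativeRing R using (trans)
  open PowerSeries R

module Evaluation (A : ℤ-Algebra) where
  open ℤ-Algebra A
  open CommutativeRing R hiding (zero)
  open RingProperties (CommutativeRing.ring R) using (-0#≈0#; -‿+-comm; -‿distribʳ-*)
  open SetoidReasoning setoid

  ev : ∀ {k} → (Fin k → Carrier) → Poly k → Carrier
  ev {zero}  v a       = ζ a
  ev {suc k} v []      = 0#
  ev {suc k} v (a ∷ p) = ev (v ∘ suc) a + v zero * ev v p

  ev-const : ∀ {k} (v : Fin k → Carrier) c → ev v (constP c) ≈ ζ c
  ev-const {zero}  v c = refl
  ev-const {suc k} v c = trans (+-cong (ev-const (v ∘ suc) c) (zeroʳ _)) (+-identityʳ _)

  ev-0 : ∀ {k} (v : Fin k → Carrier) → ev v 0P ≈ 0#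
  ev-0 {zero}  v = ζ-0
  ev-0 {suc k} v = refl

  ev-+ : ∀ {k} (v : Fin k → Carrier) p q → ev v (p +P q) ≈ ev v p + ev v q
  ev-+ {zero}  v a       b       = ζ-+ a b
  ev-+ {suc k} v []      q       = sym (+-identityˡ _)
  ev-+ {suc k} v (a ∷ p) []      = sym (+-identityʳ _)
  ev-+ {suc k} v (a ∷ p) (b ∷ q) = trans
    (+-cong (ev-+ (v ∘ suc) a b) (trans (*-congˡ (ev-+ v p q)) (distribˡ _ _ _)))
    (interchange +-commutativeSemigroup _ _ _ _)

  ev-‿ : ∀ {k} (v : Fin k → Carrier) p → ev v (-P p) ≈ - ev v p
  ev-‿ {zero}  v a       = ζ-‿ a
  ev-‿ {suc k} v []      = sym -0#≈0#
  ev-‿ {suc k} v (a ∷ p) = trans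
    (+-cong (ev-‿ (v ∘ suc) a) (trans (*-congˡ (ev-‿ v p)) (sym (-‿distribʳ-* _ _))))
    (-‿+-comm _ _)

  ev-* : ∀ {k} (v : Fin k → Carrier) p q → ev v (p *P q) ≈ ev v p * ev v q
  ev-map : ∀ {k} (v : Fin (suc k) → Carrier) a q → ev v (map (a *P_) q) ≈ ev (v ∘ suc) a * ev v q

  ev-* {zero}  v a       b = ζ-* a b
  ev-* {suc k} v []      q = sym (zeroˡ _)
  ev-* {suc k} v (a ∷ p) q = begin
    ev v (map (a *P_) q +P (0P ∷ (p *P q)))
      ≈⟨ ev-+ v (map (a *P_) q) (0P ∷ (p *P q)) ⟩
    ev v (map (a *P_) q) + (ev (v ∘ suc) 0P + v zero * ev v (p *P q))
      ≈⟨ +-cong (ev-map v a q) (trans (+-congʳ (ev-0 (v ∘ suc))) (+-identityˡ _)) ⟩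
    ev (v ∘ suc) a * ev v q + v zero * ev v (p *P q)
      ≈⟨ +-congˡ (trans (*-congˡ (ev-* v p q)) (sym (*-assoc _ _ _))) ⟩
    ev (v ∘ suc) a * ev v q + v zero * ev v p * ev v q
      ≈⟨ sym (distribʳ _ _ _) ⟩
    ev v (a ∷ p) * ev v q ∎

  ev-map v a []      = sym (zeroʳ _)
  ev-map v a (b ∷ q) = trans
    (+-cong (ev-* (v ∘ suc) a b) (trans (*-congˡ (ev-map v a q)) (x∙yz≈y∙xz *-commutativeSemigroup _ _ _)))
    (sym (distribˡ _ _ _))

  ev-zero : ∀ {k} (v : Fin k → Carrier) p → IsZeroP p → ev v p ≈ 0#
  ev-zero {zero}  v _       ≡.refl  = ζ-0
  ev-zero {suc k} v []      z       = refl
  ev-zero {suc k} v (a ∷ p) (z , w) = trans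
    (+-cong (ev-zero (v ∘ suc) a z) (trans (*-congˡ (ev-zero v p w)) (zeroʳ _))) (+-identityˡ _)

  ev-var : ∀ {k} (v : Fin k → Carrier) i → ev v (var i) ≈ v i
  ev-var {suc k} v zero    = begin
    ev (v ∘ suc) 0P + v zero * (ev (v ∘ suc) 1P + v zero * 0#)
      ≈⟨ +-cong (ev-0 (v ∘ suc)) (*-congˡ (+-cong (trans (ev-const (v ∘ suc) (+ 1)) ζ-1) (zeroʳ _))) ⟩
    0# + v zero * (1# + 0#)
      ≈⟨ trans (+-identityˡ _) (trans (*-congˡ (+-identityʳ 1#)) (*-identityʳ _)) ⟩
    v zero ∎
  ev-var {suc k} v (suc i) = trans (+-cong (ev-var (v ∘ suc) i) (zeroʳ _)) (+-identityʳ _)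

  ev-hom : ∀ {k} (v : Fin k → Carrier) → PolyHom k R
  ev-hom v = record
    { φ = ev v ; φ-0 = ev-0 v ; φ-1 = trans (ev-const v (+ 1)) ζ-1
    ; φ-+ = ev-+ v ; φ-* = ev-* v ; φ-‿ = ev-‿ v }

  ev-respects : ∀ {k} (v : Fin k → Carrier) p q → p ≈P q → ev v p ≈ ev v q
  ev-respects v p q z = begin
    ev v p                         ≈⟨ sym (+-identityʳ _) ⟩
    ev v p + 0#                    ≈⟨ +-congˡ (sym (-‿inverseˡ _)) ⟩
    ev v p + (- ev v q + ev v q)   ≈⟨ sym (+-assoc _ _ _) ⟩
    (ev v p + - ev v q) + ev v q   ≈⟨ +-congʳ (trans (+-congˡ (sym (ev-‿ v q))) (sym (ev-+ v p (-P q)))) ⟩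
    ev v (p +P (-P q)) + ev v q    ≈⟨ +-congʳ (ev-zero v _ z) ⟩
    0# + ev v q                    ≈⟨ +-identityˡ _ ⟩
    ev v q ∎

-- Staircases

length-stair : ∀ k → length (stair k) ≡ k
length-stair zero    = ≡.refl
length-stair (suc k) = ≡.cong suc (length-stair k)

part-stair : ∀ k → part (stair k) 0 ≡ k
part-stair zero    = ≡.refl
part-stair (suc k) = ≡.refl

stair-decr : ∀ k → Decr (stair k)
stair-decr zero    i = z≤n
stair-decr (suc k)   = decr-∷ (ℕ.≤-trans (ℕ.≤-reflexive (part-stair k)) (ℕ.n≤1+n k)) (stair-decr k)

partition-decr : ∀ {L} → Linked ℕ._≥_ L → Decr L
partition-decr []      i       = z≤n
partition-decr [-]     zero    = z≤n
partition-decr [-]     (suc i) = z≤n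
partition-decr (p ∷ l) zero    = p
partition-decr (p ∷ l) (suc i) = partition-decr l i

module Staircase (R : CRing) where
  open CommutativeRing R hiding (zero)
  open RingProperties (CommutativeRing.ring R) using (-‿distribˡ-*; -‿distribʳ-*)
  open PowerSeries R
  open Generating R
  open Minors R
  open JacobiTrudi R
  open SetoidReasoning setoid

  -- The two contributions of the row in between are y and -y times the same entry.
  fam-lin-lin : ∀ y g p c →
    fam (lin y ⊛ (lin (- y) ⊛ g)) (suc (suc p)) c ≈ fam g (suc (suc p)) c + - (y * y) * fam g p c
  fam-lin-lin y g p c = begin
    fam (lin y ⊛ (lin (- y) ⊛ g)) (suc (suc p)) c
      ≈⟨ fam-lin y (lin (- y) ⊛ g) (suc p) c ⟩
    fam (lin (- y) ⊛ g) (suc (suc p)) c + y * fam (lin (- y) ⊛ g) (suc p) c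
      ≈⟨ +-cong (fam-lin (- y) g (suc p) c) (trans (*-congˡ (fam-lin (- y) g p c)) (distribˡ _ _ _)) ⟩
    (g₂ + - y * g₁) + (y * g₁ + y * (- y * g₀))
      ≈⟨ trans (+-assoc _ _ _) (+-congˡ (sym (+-assoc _ _ _))) ⟩
    g₂ + ((- y * g₁ + y * g₁) + y * (- y * g₀))
      ≈⟨ +-congˡ (+-cong (trans (+-congʳ (sym (-‿distribˡ-* y g₁))) (-‿inverseˡ _))
           (trans (sym (*-assoc _ _ _)) (*-congʳ (sym (-‿distribʳ-* y y))))) ⟩
    g₂ + (0# + - (y * y) * g₀)
      ≈⟨ +-congˡ (+-identityˡ _) ⟩
    g₂ + - (y * y) * g₀ ∎
    where
    g₂ = fam g (suc (suc p)) c
    g₁ = fam g (suc p) c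
    g₀ = fam g p c

  D-stair : ∀ y g k cs →
    D (fam (lin y ⊛ (lin (- y) ⊛ g))) (pos (stair k)) cs ≈ D (fam g) (pos (stair k)) cs
  D-stair y g zero    []       = refl
  D-stair y g zero    (c ∷ cs) = refl
  D-stair y g (suc k) cs = begin
    E (fam (lin y ⊛ (lin (- y) ⊛ g)) (suc (suc r))) (D (fam (lin y ⊛ (lin (- y) ⊛ g))) (pos (stair k))) cs
      ≈⟨ E-cong (fam-lin-lin y g r) (D-stair y g k) cs ⟩
    E (λ c → fam g (suc (suc r)) c + - (y * y) * fam g r c) F cs
      ≈⟨ E-+ˡ (fam g (suc (suc r))) _ F cs ⟩
    E (fam g (suc (suc r))) F cs + E (λ c → - (y * y) * fam g r c) F cs
      ≈⟨ +-congˡ (trans (E-scaleˡ _ (fam g r) F cs) (trans (*-congˡ next) (zeroʳ _))) ⟩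
    E (fam g (suc (suc r))) F cs + 0#
      ≈⟨ +-identityʳ _ ⟩
    E (fam g (suc (suc r))) F cs ∎
    where
    r = k ℕ.+ length (stair k)
    F = D (fam g) (pos (stair k))
    -- Two steps below the first row lies the next row of the staircase, or the sentinel if k = 0.
    next : E (fam g r) F cs ≈ 0#
    next = ≡.subst (λ x → E (fam g (x ℕ.+ length (stair k))) F cs ≈ 0#) (part-stair k) (repeated-row g (stair k) cs)

  -- b is general so that it can absorb `lin y` while the other factors are exchanged. Then 1 + yz =
  -- (1 - y²z²)/(1 - yz), and `D-stair` removes the numerator.
  D-stair-lins : ∀ k cs ys b →
    D (fam (lins ys ⊛ b)) (pos (stair k)) cs ≈ D (fam (hs ys ⊛ b)) (pos (stair k)) cs
  D-stair-lins k cs []       b = refl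
  D-stair-lins k cs (y ∷ ys) b = begin
    D′ ((lin y ⊛ lins ys) ⊛ b)
      ≈⟨ D′-cong (xy∙z≈y∙xz S.*-commutativeSemigroup (lin y) (lins ys) b) ⟩
    D′ (lins ys ⊛ (lin y ⊛ b))
      ≈⟨ D-stair-lins k cs ys (lin y ⊛ b) ⟩
    D′ (hs ys ⊛ (lin y ⊛ b))
      ≈⟨ D′-cong (x∙yz≈y∙xz S.*-commutativeSemigroup (hs ys) (lin y) b) ⟩
    D′ (lin y ⊛ (hs ys ⊛ b))
      ≈⟨ D′-cong (⊛-cong (S.refl {lin y}) (S.sym (lin⊛pow⊛ y (hs ys ⊛ b)))) ⟩
    D′ (lin y ⊛ (lin (- y) ⊛ (pow y ⊛ (hs ys ⊛ b))))
      ≈⟨ D-stair y (pow y ⊛ (hs ys ⊛ b)) k cs ⟩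
    D′ (pow y ⊛ (hs ys ⊛ b))
      ≈⟨ D′-cong (S.sym (⊛-assoc (pow y) (hs ys) b)) ⟩
    D′ (hs (y ∷ ys) ⊛ b) ∎
    where
    D′ : Series → Carrier
    D′ a = D (fam a) (pos (stair k)) cs
    D′-cong : ∀ {a a′} → a ≋ a′ → D′ a ≈ D′ a′
    D′-cong e = D-fam-cong e (pos (stair k)) cs

  hook-stair : ∀ k xs ys → schurD (lins ys ⊛ hs xs) (stair k) ≈ schurD (hs (xs ++ ys)) (stair k)
  hook-stair k xs ys = trans (D-stair-lins k _ ys (hs xs))
    (schurD-cong (S.trans (⊛-comm (hs ys) (hs xs)) (S.sym (hs-++ xs ys))) (stair k))

staircase⇒equal : ∀ n m k →
  hookSchur (Xvars n m) (Yvars n m) (stair k) ≈P schur (XYvars n m) (stair k)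
staircase⇒equal n m k = ι-reflects {p = hookSchur (Xvars n m) (Yvars n m) (stair k)} (begin
  ι (hookSchur (Xvars n m) (Yvars n m) (stair k))
    ≈⟨ φ-hookSchur (Xvars n m) (Yvars n m) (stair k) (stair-decr k) ⟩
  schurD (lins (map ι (Yvars n m)) ⊛ hs (map ι (Xvars n m))) (stair k)
    ≈⟨ hook-stair k (map ι (Xvars n m)) (map ι (Yvars n m)) ⟩
  schurD (hs (map ι (Xvars n m) ++ map ι (Yvars n m))) (stair k)
    ≈⟨ reflexive (≡.cong (λ zs → schurD (hs zs) (stair k))
         (≡.trans (≡.sym (map-++ ι (Xvars n m) (Yvars n m))) (≡.cong (map ι) (≡.sym (XYvars-++ n m))))) ⟩
  schurD (hs (map ι (XYvars n m))) (stair k)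
    ≈⟨ sym (φ-schur (XYvars n m) (stair k)) ⟩
  ι (schur (XYvars n m) (stair k)) ∎)
  where
  R = iterated (n ℕ.+ m)
  open CommutativeRing R
  open PowerSeries R
  open Generating R
  open JacobiTrudi R
  open Staircase R
  open Interpret R (ι-hom (n ℕ.+ m))
  open SetoidReasoning setoid

module Theory (R : CRing) where
  open CommutativeRing R public
  open PowerSeries R public
  open Generating R public hiding (module S)
  open Sums R public
  open Minors R public
  open JacobiTrudi R public

-- Comparing minors over two rings

record GradedRelation (S R : CRing) : Set₁ where
  private
    module S = CommutativeRing S
    module R = CommutativeRing R
  field
    Rel     : ℕ → S.Carrier → R.Carrier → Set
    rel-≈   : ∀ {d u u′ v v′} → u S.≈ u′ → v R.≈ v′ → Rel d u v → Rel d u′ v′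
    rel-0   : ∀ {d} → Rel d S.0# R.0#
    rel-1   : Rel 0 S.1# R.1#
    rel-+   : ∀ {d u u′ v v′} → Rel d u v → Rel d u′ v′ → Rel d (u S.+ u′) (v R.+ v′)
    rel-neg : ∀ {d u v} → Rel d u v → Rel d (S.- u) (R.- v)
    rel-*   : ∀ {d e u u′ v v′} → Rel d u v → Rel e u′ v′ → Rel (d ℕ.+ e) (u S.* u′) (v R.* v′)

module Graded {S R : CRing} (G : GradedRelation S R) where
  open GradedRelation G
  private
    module S = Theory S
    module R = Theory R

  Rel₀ : S.Series → R.Series → Set
  Rel₀ f g = ∀ n → Rel 0 (f n) (g n)

  ⊛-rel : ∀ {f g f′ g′} → Rel₀ f g → Rel₀ f′ g′ → Rel₀ (f S.⊛ f′) (g R.⊛ g′)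
  ⊛-rel p q zero    = rel-* (p 0) (q 0)
  ⊛-rel p q (suc n) = rel-+ (rel-* (p 0) (q (suc n))) (⊛-rel (λ i → p (suc i)) q n)

  pow-rel : ∀ {s r} → Rel 0 s r → Rel₀ (S.pow s) (R.pow r)
  pow-rel p zero    = rel-1
  pow-rel p (suc n) = rel-* p (pow-rel p n)

  hs-rel : ∀ {k} {z : Fin k → S.Carrier} {w : Fin k → R.Carrier} → (∀ i → Rel 0 (z i) (w i)) →
    Rel₀ (S.hs (tabulate z)) (R.hs (tabulate w))
  hs-rel {zero}  p zero    = rel-1
  hs-rel {zero}  p (suc n) = rel-0
  hs-rel {suc k} p         = ⊛-rel (pow-rel (p zero)) (hs-rel (λ i → p (suc i)))

  -- Every product in the expansion pairs one entry of the row with one smaller minor, so all terms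
  -- share the degree bound d + e and may be added.
  E-rel : ∀ {d e} {r : ℕ → S.Carrier} {s : ℕ → R.Carrier} {F G} →
    (∀ c → Rel d (r c) (s c)) → (∀ cs → Rel e (F cs) (G cs)) →
    ∀ cs → Rel (d ℕ.+ e) (S.E r F cs) (R.E s G cs)
  E-rel p q []       = rel-0
  E-rel p q (c ∷ cs) = rel-+ (rel-* (p c) (q cs)) (rel-neg (E-rel p (λ ds → q (c ∷ ds)) cs))

  sh-rel : ∀ {f g} → Rel₀ f g → ∀ p q → Rel 0 (S.sh f p q) (R.sh g p q)
  sh-rel e p       zero    = e p
  sh-rel e zero    (suc q) = rel-0
  sh-rel e (suc p) (suc q) = sh-rel e p q

  D-rel : ∀ {f g} → Rel₀ f g → ∀ ps cs → Rel 0 (S.D (S.fam f) ps cs) (R.D (R.fam g) ps cs)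
  D-rel e []       []       = rel-1
  D-rel e []       (c ∷ cs) = rel-0
  D-rel e (p ∷ ps) cs       = E-rel (λ c → sh-rel e p (suc c)) (D-rel e ps) cs

-- Top coefficients and constant terms of power series

module Coefficients (R : CRing) where
  open CommutativeRing R hiding (zero)
  open RingProperties (CommutativeRing.ring R) using (-0#≈0#)
  open PowerSeries R

  -- v may be zero: d is a bound on the degree, which keeps the relation stable under sums and
  -- cancellation.
  record Top (d : ℕ) (u : Series) (v : Carrier) : Set where
    constructor top
    field
      above : ∀ {i} → d < i → u i ≈ 0#
      coeff : u d ≈ v

  open Top public

  Top-unique : ∀ {d u u′ v v′} → Top d u v → Top d u′ v′ → u ≋ u′ → v ≈ v′
  Top-unique {d} p q e = trans (sym (coeff p)) (trans (e d) (coeff q))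

  Top-tl : ∀ {d u v} → Top (suc d) u v → Top d (tl u) v
  Top-tl p = top (λ q → above p (s≤s q)) (coeff p)

  Top-* : ∀ {d e u u′ v v′} → Top d u v → Top e u′ v′ → Top (d ℕ.+ e) (u ⊛ u′) (v * v′)
  Top-* {zero} {e} {u} {u′} p q = top
    (λ {i} r → trans (scale i) (trans (*-congˡ (above q r)) (zeroʳ _)))
    (trans (scale e) (*-cong (coeff p) (coeff q)))
    where
    scale : ∀ i → (u ⊛ u′) i ≈ u 0 * u′ i
    scale = ⊛-constˡ u u′ (λ n → above p (s≤s z≤n))
  Top-* {suc d} {e} {u} {u′} p q = top
    (λ { {suc i} (s≤s r) → trans (drop (ℕ.≤-trans (ℕ.m≤n+m e d) (ℕ.<⇒≤ r))) (above rest r) })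
    (trans (drop (ℕ.m≤n+m e d)) (coeff rest))
    where
    rest = Top-* (Top-tl p) q
    drop : ∀ {i} → e ≤ i → (u ⊛ u′) (suc i) ≈ (tl u ⊛ u′) i
    drop e≤i = trans (+-congʳ (trans (*-congˡ (above q (s≤s e≤i))) (zeroʳ _))) (+-identityˡ _)

  Top-X : ∀ {d u v} → Top d u v → Top (suc d) (X ⊛ u) v
  Top-X {u = u} p = top (λ { {suc i} (s≤s r) → trans (X⊛-suc u i) (above p r) }) (trans (X⊛-suc u _) (coeff p))

  Top-const : ∀ v → Top 0 (const v) v
  Top-const v = top (λ { {suc i} _ → refl }) refl

  topRelation : GradedRelation seriesRing R
  topRelation = record
    { Rel     = Top
    ; rel-≈   = λ e f p → top (λ {i} r → trans (sym (e i)) (above p r)) (trans (sym (e _)) (trans (coeff p) f))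
    ; rel-0   = top (λ _ → refl) refl
    ; rel-1   = Top-const 1#
    ; rel-+   = λ p q → top (λ r → trans (+-cong (above p r) (above q r)) (+-identityˡ 0#)) (+-cong (coeff p) (coeff q))
    ; rel-neg = λ p → top (λ r → trans (-‿cong (above p r)) -0#≈0#) (-‿cong (coeff p))
    ; rel-*   = Top-*
    }

  -- The homomorphism X ↦ 0, in the same interface with the degree ignored.
  constantTerm : GradedRelation seriesRing R
  constantTerm = record
    { Rel     = λ _ u v → u 0 ≈ v
    ; rel-≈   = λ e f p → trans (sym (e 0)) (trans p f)
    ; rel-0   = refl
    ; rel-1   = refl
    ; rel-+   = +-cong
    ; rel-neg = -‿cong
    ; rel-*   = *-cong
    }

shift : List ℕ → List ℕ
shift []       = []
shift (l ∷ ls) = part ls 0 ∷ shift ls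

length-shift : ∀ L → length (shift L) ≡ length L
length-shift []       = ≡.refl
length-shift (l ∷ ls) = ≡.cong suc (length-shift ls)

shift-∷ : ∀ l ls → shift (l ∷ ls) ≡ ls ++ 0 ∷ []
shift-∷ l []       = ≡.refl
shift-∷ l (m ∷ ms) = ≡.cong (m ∷_) (shift-∷ m ms)

-- Top coefficients

module TopCoefficient (R : CRing) where
  open CommutativeRing R hiding (zero)
  open PowerSeries R
  open Generating R using (pow; hs; hs-0)
  open Minors R using (D)
  open JacobiTrudi R using (fam; schurD; D-pad1)
  open Coefficients R
  open Graded topRelation
  open GradedRelation topRelation
  private
    module S = Theory seriesRing

  module _ {g′ : S.Series} {g : Series} (g′~g : Rel₀ g′ g) where

    private
      G = S.pow X S.⊛ g′

    -- The exponent d + b - x equals d only for x = b, so the top coefficient is the entry in the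
    -- row of the lowest part b.
    row-top : ∀ d b n c →
      Top d (S.Sum (down d b) (λ x → S.pow X (d ℕ.+ b ∸ x) ⊛ S.fam g′ (suc (x ℕ.+ n)) c)) (fam g (suc (b ℕ.+ n)) c)
    row-top zero    b n c rewrite ℕ.n∸n≡0 b =
      rel-≈ (S.sym (S.trans (S.+-identityʳ (S.1# ⊛ t)) (S.*-identityˡ t))) refl (sh-rel g′~g (suc (b ℕ.+ n)) (suc c))
      where t = S.fam g′ (suc (b ℕ.+ n)) c
    row-top (suc d) b n c = rel-≈ (S.+-cong
        (S.sym (S.trans (S.*-cong (S.reflexive (≡.cong (S.pow X) (ℕ.n∸n≡0 (d ℕ.+ b)))) (S.refl {t})) (S.*-identityˡ t)))
        (S.trans (S.sym (S.Sum-scale (down d b) X (λ x → S.pow X (d ℕ.+ b ∸ x) ⊛ row x))) (S.Sum-cong∈ (down d b) raise)))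
      (+-identityˡ _)
      (rel-+ low (Top-X (row-top d b n c)))
      where
      row : ℕ → Series
      row x = S.fam g′ (suc (x ℕ.+ n)) c
      t = row (suc d ℕ.+ b)
      -- The term with exponent 0 has degree 0 in `X` and therefore coefficient 0 in degree suc d.
      low : Top (suc d) t 0#
      low = top (λ { {suc i} _ → above (sh-rel g′~g (suc (suc d ℕ.+ b ℕ.+ n)) (suc c)) (s≤s z≤n) })
                (above (sh-rel g′~g (suc (suc d ℕ.+ b ℕ.+ n)) (suc c)) (s≤s z≤n))
      raise : ∀ {x} → x ∈ down d b →
        (X ⊛ (S.pow X (d ℕ.+ b ∸ x) ⊛ row x)) S.≈ (S.pow X (suc d ℕ.+ b ∸ x) ⊛ row x)
      raise {x} m rewrite ℕ.+-∸-assoc 1 (proj₂ (∈-down⁻ d m)) = S.sym (S.*-assoc X (S.pow X (d ℕ.+ b ∸ x)) (row x))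

    -- The i-th row has degree at most α_i - α_{i+1} and its top coefficient is the row of α_{i+1}.
    -- The degrees telescope to α₁, and the parts move up by one place.
    D-top : ∀ α → Decr α → ∀ cs → Top (part α 0) (S.D (S.fam G) (pos α) cs) (D (fam g) (pos (shift α)) cs)
    D-top []       d []       = rel-1
    D-top []       d (c ∷ cs) = rel-0
    D-top (l ∷ ls) d cs rewrite length-shift ls = rel-≈ (S.sym (S.D-pow-row X g′ l ls (d 0) cs)) refl
      (≡.subst (λ e → Top e (S.E row (S.D (S.fam G) (pos ls)) cs) _) (ℕ.m∸n+n≡m (d 0))
        (E-rel row-top′ (D-top ls (decr-tail d)) cs))
      where
      δ = l ∸ part ls 0
      row : ℕ → Series
      row c = S.Sum (down δ (part ls 0)) (λ x → S.pow X (l ∸ x) ⊛ S.fam g′ (suc (x ℕ.+ length ls)) c)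
      row-top′ : ∀ c → Top δ (row c) (fam g (suc (part ls 0 ℕ.+ length ls)) c)
      row-top′ c = ≡.subst
        (λ e → Top δ (S.Sum (down δ (part ls 0)) (λ x → S.pow X (e ∸ x) ⊛ S.fam g′ (suc (x ℕ.+ length ls)) c))
               (fam g (suc (part ls 0 ℕ.+ length ls)) c))
        (ℕ.m∸n+n≡m (d 0)) (row-top δ (part ls 0) (length ls) c)

    schurD-top : g 0 ≈ 1# → ∀ l ls → Decr (l ∷ ls) → Top l (S.schurD G (l ∷ ls)) (schurD g ls)
    schurD-top g-0 l ls d = rel-≈ S.refl
      -- `shift` keeps the number of rows by ending in 0; that row is now removed together with the
      -- last column.
      (trans (reflexive (≡.cong₂ (λ α γ → D (fam g) (pos α) (β γ)) (shift-∷ l ls) (≡.sym (zeros-snoc (length ls)))))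
             (D-pad1 g g-0 ls (zeros (length ls))))
      (D-top (l ∷ ls) d (β (zeros (suc (length ls)))))

  extend : ∀ {k} → (Fin k → Carrier) → Fin (suc k) → Series
  extend z zero    = X
  extend z (suc i) = const (z i)

-- Nonvanishing of Schur polynomials and independence of t

Elem : ℤ-Algebra → Set
Elem A = CommutativeRing.Carrier (ℤ-Algebra.R A)

-- Vanishing in every ℤ-algebra stands for vanishing as a polynomial and survives passage to a
-- coefficient.
Vanishes : List ℕ → ℕ → Set₁
Vanishes ν k = ∀ (A : ℤ-Algebra) (z : Fin k → Elem A) →
  let open ℤ-Algebra A; open CommutativeRing R; open Generating R; open JacobiTrudi R
  in schurD (hs (tabulate z)) ν ≈ 0#

-- Taking top coefficients in one variable after another strips the rows one by one. The empty minor
-- 1 is reached before the variables run out, and 1 ≠ 0 in ℤ.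
schur-nonzero : ∀ k ν → Decr ν → length ν ≤ k → ¬ Vanishes ν k
schur-nonzero k       []       d p v with () ← v integers (λ _ → + 0)
schur-nonzero (suc k) (l ∷ ls) d (s≤s p) v = schur-nonzero k ls (decr-tail d) p λ A z →
  let open ℤ-Algebra A
      open PowerSeries R
      open Generating R
      open Coefficients R
      open TopCoefficient R
      open Graded topRelation
      open GradedRelation topRelation
  in Top-unique (schurD-top (hs-rel (λ i → Top-const (z i))) (hs-0 (tabulate z)) l ls d)
       (rel-0 {l}) (v (series A) (extend z))

-- s_L(z₁,…,z_k,t,−t) does not depend on t
Independent : List ℕ → ℕ → Set₁
Independent L k = ∀ (A : ℤ-Algebra) (z : Fin k → Elem A) (t : Elem A) →
  let open ℤ-Algebra A; open CommutativeRing R; open PowerSeries R; open Generating R; open JacobiTrudi R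
  in schurD (pow t ⊛ (pow (- t) ⊛ hs (tabulate z))) L ≈ schurD (hs (tabulate z)) L

-- Both sides are polynomials in a new variable z₁; compare their coefficients of degree l.
-- `commute` brings the factor of z₁ to the front, where `schurD-top` expects it.
independent-tail : ∀ {l ls k} → Decr (l ∷ ls) → Independent (l ∷ ls) (suc k) → Independent ls k
independent-tail {l} {ls} d ind A z t =
  Top-unique
    (schurD-top (⊛-rel (pow-rel (Top-const t)) (⊛-rel (pow-rel (rel-neg (Top-const t))) g~))
      (R.trans (R.*-identityˡ _) (R.trans (R.*-identityˡ _) (hs-0 (tabulate z)))) l ls d)
    (schurD-top g~ (hs-0 (tabulate z)) l ls d)
    (S.trans (S.schurD-cong commute (l ∷ ls)) (ind (series A) (extend z) (const t)))
  where
  open ℤ-Algebra A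
  module R = CommutativeRing R
  open PowerSeries R
  module S = Theory seriesRing
  module SS = CommutativeRing S.seriesRing
  open Generating R hiding (module S)
  open Coefficients R
  open TopCoefficient R
  open Graded topRelation
  open GradedRelation topRelation
  z′ : Fin _ → Series
  z′ i = const (z i)
  g~ : Rel₀ (S.hs (tabulate z′)) (hs (tabulate z))
  g~ = hs-rel (λ i → Top-const (z i))
  p₁ = S.pow (const t)
  p₂ = S.pow (S.- const t)
  g′ = S.hs (tabulate z′)
  commute : S.pow X S.⊛ (p₁ S.⊛ (p₂ S.⊛ g′)) S.≋ p₁ S.⊛ (p₂ S.⊛ (S.pow X S.⊛ g′))
  commute = SS.trans (x∙yz≈y∙xz SS.*-commutativeSemigroup (S.pow X) p₁ (p₂ S.⊛ g′))
    (SS.*-congˡ {p₁} (x∙yz≈y∙xz SS.*-commutativeSemigroup (S.pow X) p₂ g′))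

-- The coefficient of t² in s_{(a+1, δ_j)}(z, t, −t): in the rows of the
-- staircase δ_j the change of series is invisible, so only the first row moves.
second-coefficient : ∀ {a j k} → Independent (suc a ∷ stair j) k → ∀ (A : ℤ-Algebra) (z : Fin k → Elem A) →
  let open ℤ-Algebra A; open CommutativeRing R; open Generating R; open Minors R; open JacobiTrudi R
  in E (fam (hs (tabulate z)) (a ℕ.+ length (stair j))) (D (fam (hs (tabulate z))) (pos (stair j)))
       (β (zeros (suc (length (stair j))))) ≈ 0#
second-coefficient {a} {j} ind A z =
  R.trans (R.sym (E-rel {0} {0} {F = F} (λ c → sh-rel {G} G~ p (suc c)) (D-rel {g′} g~ (pos (stair j))) cols)) (E≈0 0)
  where
  open ℤ-Algebra A
  module R = CommutativeRing R
  open PowerSeries R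
  module S = Theory seriesRing
  module SS = CommutativeRing S.seriesRing
  open Generating R hiding (module S)
  open Coefficients R
  open Graded constantTerm
  open SetoidReasoning S.setoid

  -- The row index belonging to a first part a - 1, two below that of a + 1; as a row index it makes
  -- sense for a = 0 too.
  p = a ℕ.+ length (stair j)
  cols = β (zeros (suc (length (stair j))))
  g = hs (tabulate z)
  z′ : Fin _ → Series
  z′ i = const (z i)
  g′ = S.hs (tabulate z′)
  G = S.pow X S.⊛ (S.pow (S.- X) S.⊛ g′)
  F = S.D (S.fam g′) (pos (stair j))

  g~ : Rel₀ g′ g
  g~ = hs-rel {z = z′} (λ i → R.refl)

  G~ : Rel₀ G g
  G~ n = R.trans
    (⊛-rel {S.pow X} {pow R.0#} (pow-rel {X} R.refl)
      (⊛-rel {S.pow (S.- X)} {pow R.0#} {g′} (pow-rel {S.- X} (RingProperties.-0#≈0# R.ring)) g~) n)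
    (R.trans (⊛-cong pow-0 (⊛-cong {g = g} pow-0 (λ _ → R.refl)) n)
      (R.trans (⊛-identityˡ _ n) (⊛-identityˡ g n)))

  -- That is, g′ = (1 - X²z²)G, so the staircase argument applies to `G` and g′.
  lin-lin-G : S.lin X S.⊛ (S.lin (S.- X) S.⊛ G) S.≋ g′
  lin-lin-G = SS.trans (SS.*-congˡ {S.lin X} (S.lin⊛pow⊛ X (S.pow (S.- X) S.⊛ g′)))
    (SS.trans (SS.sym (S.⊛-assoc (S.lin X) (S.pow (S.- X)) g′))
      (SS.trans (SS.*-congʳ {g′} (S.lin-pow′ X)) (S.⊛-identityˡ g′)))

  F≈ : ∀ cs → S.D (S.fam G) (pos (stair j)) cs S.≈ F cs
  F≈ cs = S.trans (S.sym (Staircase.D-stair seriesRing X G j cs)) (S.D-fam-cong lin-lin-G (pos (stair j)) cs)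

  row : ∀ c → S.fam g′ (suc (suc p)) c S.≈ S.fam G (suc (suc p)) c S.+ (S.- (X S.* X)) S.* S.fam G p c
  row c = S.trans (S.sym (S.fam-cong lin-lin-G (suc (suc p)) c)) (Staircase.fam-lin-lin seriesRing X G p c)

  u = S.E (S.fam G p) F cols
  v = S.E (S.fam G (suc (suc p))) F cols

  -- The left side is the minor of g′, expanded in its first row, and v is the minor of `G`.
  -- Independence at t = X equates the two.
  XXu≈0 : v S.+ (S.- (X S.* X)) S.* u S.≈ v S.+ S.0#
  XXu≈0 = begin
    v S.+ (S.- (X S.* X)) S.* u
      ≈⟨ S.+-congˡ {v} (S.sym (S.E-scaleˡ (S.- (X S.* X)) (S.fam G p) F cols)) ⟩
    v S.+ S.E (λ c → (S.- (X S.* X)) S.* S.fam G p c) F cols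
      ≈⟨ S.sym (S.E-+ˡ (S.fam G (suc (suc p))) (λ c → (S.- (X S.* X)) S.* S.fam G p c) F cols) ⟩
    S.E (λ c → S.fam G (suc (suc p)) c S.+ (S.- (X S.* X)) S.* S.fam G p c) F cols
      ≈⟨ S.sym (S.E-cong row (λ cs → S.refl {F cs}) cols) ⟩
    S.schurD g′ (suc a ∷ stair j)
      ≈⟨ S.sym (ind (series A) z′ X) ⟩
    S.schurD G (suc a ∷ stair j)
      ≈⟨ S.E-cong (λ c → S.refl {S.fam G (suc (suc p)) c}) F≈ cols ⟩
    v
      ≈⟨ S.sym (S.+-identityʳ v) ⟩
    v S.+ S.0# ∎

  E≈0 : ∀ n → u n R.≈ R.0#
  -- Multiplication by `X` is a shift, so X² can be cancelled over any ring.
  E≈0 n = R.trans (R.sym (R.trans (X⊛-suc (X ⊛ u) (suc n)) (X⊛-suc u n))) (X[Xu]≈0 (suc (suc n)))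
    where
    open RingProperties S.ring using (+-cancelˡ; -‿involutive; -‿distribˡ-*; -0#≈0#)
    X[Xu]≈0 : X ⊛ (X ⊛ u) S.≈ S.0#
    X[Xu]≈0 = begin
      X ⊛ (X ⊛ u)                          ≈⟨ S.sym (S.*-assoc X X u) ⟩
      (X S.* X) S.* u                      ≈⟨ S.sym (-‿involutive _) ⟩
      S.- (S.- ((X S.* X) S.* u))          ≈⟨ S.-‿cong (-‿distribˡ-* (X S.* X) u) ⟩
      S.- ((S.- (X S.* X)) S.* u)          ≈⟨ S.-‿cong (+-cancelˡ v ((S.- (X S.* X)) S.* u) S.0# XXu≈0) ⟩
      S.- S.0#                             ≈⟨ -0#≈0# ⟩
      S.0# ∎

-- The minor of `second-coefficient` has a row for a - 1 above those of δ_j. Unless a = j, sorting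
-- its rows gives, up to sign, a Schur polynomial with j + 1 ≤ k rows, which is not zero.
first-row : ∀ {a j k} → Independent (suc a ∷ stair j) k → suc j ≤ k → j ≤ suc a → a ≡ j
first-row {a} {j} {k} ind j<k j≤ with ℕ.<-cmp a j
... | tri≈ _ e _ = e
-- Here b = a - 1 ≥ j, and (b, δ_j) is already a partition.
... | tri> _ _ (s≤s {n = b} j≤b) = ⊥-elim (schur-nonzero k (b ∷ stair j)
        (decr-∷ (ℕ.≤-trans (ℕ.≤-reflexive (part-stair j)) j≤b) (stair-decr j))
        (ℕ.≤-trans (ℕ.≤-reflexive (≡.cong suc (length-stair j))) j<k)
        (second-coefficient {suc b} {j} ind))
-- Now j = a + 1, and the row for a - 1 has index one less than the first row of δ_j. Exchanging
-- these two rows gives the minor of (a, a, δ_a).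
... | tri< a<j _ _ with ℕ.≤-antisym a<j j≤
...   | ≡.refl = ⊥-elim (schur-nonzero k (a ∷ a ∷ stair a)
        (decr-∷ ℕ.≤-refl (decr-∷ (ℕ.≤-reflexive (part-stair a)) (stair-decr a)))
        (ℕ.≤-trans (ℕ.≤-reflexive (≡.cong (λ n → suc (suc n)) (length-stair a))) j<k)
        vanish)
  where
  vanish : Vanishes (a ∷ a ∷ stair a) k
  vanish A z = begin
    E (fam g (suc (a ℕ.+ suc n))) (E (fam g (suc (a ℕ.+ n))) F) cols
      ≈⟨ reflexive (≡.cong₂ (λ p q → E (fam g p) (E (fam g q) F) cols)
           (≡.cong suc (ℕ.+-suc a n)) (≡.sym (ℕ.+-suc a n))) ⟩
    E (fam g (suc (suc a ℕ.+ n))) (E (fam g (a ℕ.+ suc n)) F) cols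
      ≈⟨ E-anticomm (fam g (suc (suc a ℕ.+ n))) (fam g (a ℕ.+ suc n)) F cols ⟩
    - E (fam g (a ℕ.+ suc n)) (E (fam g (suc (suc a ℕ.+ n))) F) cols
      ≈⟨ trans (-‿cong (second-coefficient {a} {suc a} ind A z)) -0#≈0# ⟩
    0# ∎
    where
    open ℤ-Algebra A
    open CommutativeRing R
    open RingProperties (CommutativeRing.ring R) using (-0#≈0#)
    open Generating R
    open Minors R
    open JacobiTrudi R
    open SetoidReasoning setoid
    n = length (stair a)
    g = hs (tabulate z)
    F = D (fam g) (pos (stair a))
    cols = β (zeros (suc (suc n)))

independent⇒staircase : ∀ k L → Decr L → All>0 L → length L ≤ k → Independent L k → IsStaircase L
independent⇒staircase k       []           d a       p       ind = 0 , ≡.refl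
independent⇒staircase (suc k) (suc l ∷ ls) d (_ ∷ a) (s≤s p) ind
  with independent⇒staircase k ls (decr-tail d) a p (independent-tail d ind)
... | j , ≡.refl
    with first-row {l} {j} ind (s≤s (≡.subst (_≤ k) (length-stair j) p)) (≡.subst (_≤ suc l) (part-stair j) (d 0))
...   | ≡.refl = suc l , ≡.refl

-- Specialisation at x₁ = t, y₁ = -t

module Specialise (A : ℤ-Algebra) where
  open ℤ-Algebra A
  open CommutativeRing R hiding (zero)
  open PowerSeries R
  open Generating R
  open JacobiTrudi R
  open Evaluation A

  pow-cong : ∀ {s t} → s ≈ t → pow s ≋ pow t
  pow-cong e zero    = refl
  pow-cong e (suc n) = *-cong e (pow-cong e n)

  lin-cong : ∀ {s t} → s ≈ t → lin s ≋ lin t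
  lin-cong e zero          = refl
  lin-cong e (suc zero)    = e
  lin-cong e (suc (suc n)) = refl

  hs-cong : ∀ {k} {f g : Fin k → Carrier} → (∀ i → f i ≈ g i) → hs (tabulate f) ≋ hs (tabulate g)
  hs-cong {zero}  e = S.refl
  hs-cong {suc k} e = ⊛-cong (pow-cong (e zero)) (hs-cong (λ i → e (suc i)))

  lins-cong : ∀ {k} {f g : Fin k → Carrier} → (∀ i → f i ≈ g i) → lins (tabulate f) ≋ lins (tabulate g)
  lins-cong {zero}  e = S.refl
  lins-cong {suc k} e = ⊛-cong (lin-cong (e zero)) (lins-cong (λ i → e (suc i)))

  specialise : ∀ n m L → Decr L → hookSchur (Xvars n m) (Yvars n m) L ≈P schur (XYvars n m) L →
    (f : Fin n → Carrier) (g : Fin m → Carrier) →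
    schurD (lins (tabulate g) ⊛ hs (tabulate f)) L ≈ schurD (hs (tabulate f) ⊛ hs (tabulate g)) L
  specialise n m L d eq f g = begin
    schurD (lins (tabulate g) ⊛ hs (tabulate f)) L
      ≈⟨ schurD-cong (⊛-cong (S.sym linsY) (S.sym hsX)) L ⟩
    schurD (lins (map (ev v) (Yvars n m)) ⊛ hs (map (ev v) (Xvars n m))) L
      ≈⟨ sym (φ-hookSchur (Xvars n m) (Yvars n m) L d) ⟩
    ev v (hookSchur (Xvars n m) (Yvars n m) L)
      ≈⟨ ev-respects v _ _ eq ⟩
    ev v (schur (XYvars n m) L)
      ≈⟨ φ-schur (XYvars n m) L ⟩
    schurD (hs (map (ev v) (XYvars n m))) L
      ≈⟨ reflexive (≡.cong (λ zs → schurD (hs zs) L)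
           (≡.trans (≡.cong (map (ev v)) (XYvars-++ n m)) (map-++ (ev v) (Xvars n m) (Yvars n m)))) ⟩
    schurD (hs (map (ev v) (Xvars n m) ++ map (ev v) (Yvars n m))) L
      ≈⟨ schurD-cong (S.trans (hs-++ (map (ev v) (Xvars n m)) (map (ev v) (Yvars n m))) (⊛-cong hsX hsY)) L ⟩
    schurD (hs (tabulate f) ⊛ hs (tabulate g)) L ∎
    where
    open SetoidReasoning setoid
    v : Fin (n ℕ.+ m) → Carrier
    v i = [ f , g ]′ (splitAt n i)
    open Interpret R (ev-hom v)

    evX : ∀ i → ev v (var (i ↑ˡ m)) ≈ f i
    evX i = trans (ev-var v (i ↑ˡ m)) (reflexive (≡.cong [ f , g ]′ (splitAt-↑ˡ n i m)))
    evY : ∀ j → ev v (var (n ↑ʳ j)) ≈ g j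
    evY j = trans (ev-var v (n ↑ʳ j)) (reflexive (≡.cong [ f , g ]′ (splitAt-↑ʳ n m j)))

    map-map-allFin : ∀ {k} (e : Fin k → Poly (n ℕ.+ m)) → map (ev v) (map e (allFin k)) ≡ tabulate (λ i → ev v (e i))
    map-map-allFin e = ≡.trans (≡.cong (map (ev v)) (map-tabulate id e)) (map-tabulate e (ev v))

    hsX : hs (map (ev v) (Xvars n m)) ≋ hs (tabulate f)
    hsX = S.trans (S.reflexive (≡.cong hs (map-map-allFin (λ i → var (i ↑ˡ m))))) (hs-cong evX)
    hsY : hs (map (ev v) (Yvars n m)) ≋ hs (tabulate g)
    hsY = S.trans (S.reflexive (≡.cong hs (map-map-allFin (λ j → var (n ↑ʳ j))))) (hs-cong evY)
    linsY : lins (map (ev v) (Yvars n m)) ≋ lins (tabulate g)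
    linsY = S.trans (S.reflexive (≡.cong lins (map-map-allFin (λ j → var (n ↑ʳ j))))) (lins-cong evY)

  cons : ∀ {k} → Carrier → (Fin k → Carrier) → Fin (suc k) → Carrier
  cons t f zero    = t
  cons t f (suc i) = f i

  -- x₁ = t and y₁ = −t contribute (1 − tz)/(1 − tz) = 1 to the series of the hook Schur polynomial.
  cancellation : ∀ n m L → Decr L →
    hookSchur (Xvars (suc n) (suc m)) (Yvars (suc n) (suc m)) L ≈P schur (XYvars (suc n) (suc m)) L →
    (z : Fin (n ℕ.+ m) → Carrier) (t : Carrier) →
    schurD (lins (tabulate (λ j → z (n ↑ʳ j))) ⊛ hs (tabulate (λ i → z (i ↑ˡ m)))) L
      ≈ schurD (pow t ⊛ (pow (- t) ⊛ hs (tabulate z))) L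
  cancellation n m L d eq z t = begin
    schurD (l ⊛ x) L
      ≈⟨ schurD-cong cancel L ⟩
    schurD ((lin (- t) ⊛ l) ⊛ (pow t ⊛ x)) L
      ≈⟨ specialise (suc n) (suc m) L d eq (cons t (λ i → z (i ↑ˡ m))) (cons (- t) (λ j → z (n ↑ʳ j))) ⟩
    schurD ((pow t ⊛ x) ⊛ (pow (- t) ⊛ y)) L
      ≈⟨ schurD-cong regroup L ⟩
    schurD (pow t ⊛ (pow (- t) ⊛ hs (tabulate z))) L ∎
    where
    open SetoidReasoning setoid
    l = lins (tabulate (λ j → z (n ↑ʳ j)))
    x = hs (tabulate (λ i → z (i ↑ˡ m)))
    y = hs (tabulate (λ j → z (n ↑ʳ j)))
    cancel : l ⊛ x ≋ (lin (- t) ⊛ l) ⊛ (pow t ⊛ x)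
    cancel = S.sym (S.trans (interchange S.*-commutativeSemigroup (lin (- t)) l (pow t) x)
      (S.trans (S.*-congʳ {l ⊛ x} (lin-pow t)) (⊛-identityˡ (l ⊛ x))))
    regroup : (pow t ⊛ x) ⊛ (pow (- t) ⊛ y) ≋ pow t ⊛ (pow (- t) ⊛ hs (tabulate z))
    regroup = S.trans (interchange S.*-commutativeSemigroup (pow t) x (pow (- t)) y)
      (S.trans (⊛-assoc (pow t) (pow (- t)) (x ⊛ y))
        (S.*-congˡ {pow t} (S.*-congˡ {pow (- t)} (S.trans (S.sym (hs-++ (tabulate (λ i → z (i ↑ˡ m))) (tabulate (λ j → z (n ↑ʳ j)))))
          (S.reflexive (≡.cong hs (≡.sym (tabulate-↑ n z))))))))

  no-t : ∀ g → pow 0# ⊛ (pow (- 0#) ⊛ g) ≋ g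
  no-t g = S.trans (⊛-cong pow-0 (⊛-cong (S.trans (pow-cong (RingProperties.-0#≈0# (CommutativeRing.ring R))) pow-0) (S.refl {g})))
    (S.trans (⊛-identityˡ _) (⊛-identityˡ g))

-- The hook side of `cancellation` is free of t, so the values at t and at 0 agree; at 0 both extra
-- factors are 1.
equal⇒independent : ∀ n m L → Decr L →
  hookSchur (Xvars (suc n) (suc m)) (Yvars (suc n) (suc m)) L ≈P schur (XYvars (suc n) (suc m)) L →
  Independent L (n ℕ.+ m)
equal⇒independent n m L d eq A z t =
  trans (sym (cancellation n m L d eq z t))
    (trans (cancellation n m L d eq z 0#) (schurD-cong (no-t (hs (tabulate z))) L))
  where
  open ℤ-Algebra A
  open CommutativeRing R
  open Generating R
  open JacobiTrudi R
  open Specialise A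

open import Data.Nat using (_+_)

theorem5p11 : (n m : ℕ) → 1 ≤ n → 1 ≤ m → (L : List ℕ) → IsPartition L →
    length L ≤ n + m ∸ 2 →
    (hookSchur (Xvars n m) (Yvars n m) L ≈P schur (XYvars n m) L) ⇔ IsStaircase L
theorem5p11 (suc n) (suc m) _ _ L (linked , positive) len = mk⇔
  (λ eq → independent⇒staircase (n + m) L d positive (≡.subst (length L ≤_) (≡.cong (_∸ 1) (ℕ.+-suc n m)) len)
            (equal⇒independent n m L d eq))
  (λ { (k , ≡.refl) → staircase⇒equal (suc n) (suc m) k })
  where d = partition-decr linked
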